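{- Let $n\ge1$ and $r\ge1$ be integers, let $\mathbf{m}\in\mathbb{Z}_{>0}^n$ be one of the vectors $(1,\dots,1)$, $(2,\dots,2)$, $(2,\dots,2,1)$, and let $\mathbf{r}=(r,\dots,r)\in\mathbb{Z}^n$. Then the colored multiset Eulerian polynomial $A_{\mathbf{m}}^{\mathbf{r}}$ is $s$-Eulerian, i.e. there exist a sequence of positive integers $s=(s_1,s_2,\dots)$ and an integer $N\ge1$ such that $A_{\mathbf{m}}^{\mathbf{r}}=E_N^s$.
   Context: Let $m=m_1+\cdots+m_n$. A colored multiset permutation in $\mathfrak{S}_{\mathbf{m}}^{\mathbf{r}}$ (for $\mathbf{m}=(m_1,\dots,m_n)$, $\mathbf{r}=(r_1,\dots,r_n)$ positive integer vectors) is a word $\pi^{\mathbf{c}}=\pi_1^{c_1}\cdots\pi_m^{c_m}$ in which each $k\in\{1,\dots,n\}$ appears exactly $m_k$ times among $\pi_1,\dots,\pi_m$, and $1\le c_j\le r_{\pi_j}$ for all $j$. One always appends $\pi_{m+1}^{c_{m+1}}:=(n+1)^1$. Colored letters are totally ordered by $k^{c}<l^{c'}$ iff $c<c'$, or $c=c'$ and $k<l$. A descent is an index $j\in\{1,\dots,m\}$ with $\pi_j^{c_j}>\pi_{j+1}^{c_{j+1}}$, and $\mathrm{des}(\pi^{\mathbf{c}})$ is the number of descents. $A_{\mathbf{m}}^{\mathbf{r}}=\sum_{\pi^{\mathbf{c}}\in\mathfrak{S}_{\mathbf{m}}^{\mathbf{r}}}x^{\mathrm{des}(\pi^{\mathbf{c}})}$.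 For a sequence of positive integers $s=(s_1,s_2,\dots)$ and $N\ge1$, the $s$-lecture hall simplex is $P_N^s=\{x\in\mathbb{R}^N:0\le x_1/s_1\le\cdots\le x_N/s_N\le1\}$, a lattice polytope, and the $s$-Eulerian polynomial is $E_N^s=h^*(P_N^s;x)$. Here, for a $d$-dimensional lattice polytope $P$, $h^*(P;x)$ is the polynomial defined by $1+\sum_{t>0}|tP\cap\mathbb{Z}^N|x^t=h^*(P;x)/(1-x)^{d+1}$. Equivalently, $E_N^s=\sum_{e}x^{\mathrm{asc}(e)}$ over all $e\in\mathbb{Z}^N$ with $0\le e_i\le s_i-1$, where $\mathrm{asc}(e)=|\{i\in\{0,\dots,N-1\}:e_i/s_i<e_{i+1}/s_{i+1}\}|$ with $e_0:=0$, $s_0:=1$. -}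

module Defs where

open import Data.Bool.Base using (if_then_else_)
open import Data.Fin.Base as Fin using (Fin; toℕ)
import Data.Fin.Properties as Fin
open import Data.Integer.Base as ℤ using (ℤ; +_; 0ℤ; 1ℤ; -1ℤ)
import Data.Integer.Properties as ℤ
open import Data.List.Base as List using (List; []; _∷_)
open import Data.List.Membership.Propositional using (_∈_)
open import Data.List.Relation.Unary.Unique.Propositional using (Unique)
open import Data.Nat.Base as ℕ using (ℕ; zero; suc; NonZero; _∸_)
import Data.Nat.Properties as ℕ
open import Data.Product.Base using (Σ-syntax; ∃-syntax; _×_; _,_)
open import Data.Product.Relation.Binary.Lex.Strict using (×-Lex; ×-decidable)
open import Data.Rational.Base as ℚ using (ℚ; 0ℚ; 1ℚ)
open import Data.Vec.Base as Vec using (Vec; []; _∷_; _∷ʳ_; lookup)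
open import Data.Vec.Relation.Unary.Linked using (Linked)
open import Function.Bundles using (_⇔_)
open import Level using (0ℓ)
open import Relation.Binary.Core using (Rel)
open import Relation.Binary.Definitions using (Decidable)
open import Relation.Binary.PropositionalEquality.Core using (_≡_; _≗_)
open import Relation.Nullary.Decidable using (does)
open import Relation.Unary using (Pred)
import Relation.Unary as Unary

open import Algebra.Properties.Semiring.Sum ℤ.+-*-semiring using (sum)

------------------------------------------------------------------------
-- Formal power series over ℤ

-- A series is its sequence of coefficients; a polynomial is a series
-- whose coefficients eventually vanish.

Series : Set
Series = ℕ → ℤ

IsPolynomial : Pred Series 0ℓ
IsPolynomial f = ∃[ D ] (∀ j → D ℕ.< j → f j ≡ 0ℤ)

infixl 6 _⊕_
infixl 7 _⊛_
infixr 8 _^ₛ_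

0ₛ : Series
0ₛ _ = 0ℤ

_⊕_ : Series → Series → Series
(f ⊕ g) j = f j ℤ.+ g j

_⊛_ : Series → Series → Series
(f ⊛ g) j = sum {suc j} λ i → f (toℕ i) ℤ.* g (j ∸ toℕ i)

x^_ : ℕ → Series
(x^ k) j = if does (k ℕ.≟ j) then 1ℤ else 0ℤ

_^ₛ_ : Series → ℕ → Series
f ^ₛ zero  = x^ 0
f ^ₛ suc k = f ⊛ f ^ₛ k

1-x : Series
1-x 0 = 1ℤ
1-x 1 = -1ℤ
1-x _ = 0ℤ

------------------------------------------------------------------------
-- Colored multiset permutations

-- Letters and colors are numbered from 0, so k^c is (k-1) ⟨ c-1 ⟩.

record Letter {n} (r : Vec ℕ n) : Set where
  constructor _⟨_⟩
  field
    value : Fin n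
    color : Fin (lookup r value)

open Letter

letters : ∀ {n} (r : Vec ℕ n) → List (Letter r)
letters {n} r =
  List.concatMap (λ k → List.map (k ⟨_⟩) (List.allFin (lookup r k))) (List.allFin n)

words : ∀ {n} (r : Vec ℕ n) (l : ℕ) → List (Vec (Letter r) l)
words r zero    = [] ∷ []
words r (suc l) = List.cartesianProductWith _∷_ (letters r) (words r l)

multiplicity : ∀ {n l} {r : Vec ℕ n} → Fin n → Vec (Letter r) l → ℕ
multiplicity k = Vec.count λ a → value a Fin.≟ k

HasContent : ∀ {n l} {r : Vec ℕ n} → Vec ℕ n → Pred (Vec (Letter r) l) 0ℓ
HasContent m w = ∀ k → multiplicity k w ≡ lookup m k

hasContent? : ∀ {n l} {r : Vec ℕ n} (m : Vec ℕ n) →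
              Unary.Decidable (HasContent {l = l} {r} m)
hasContent? m w = Fin.all? λ k → multiplicity k w ℕ.≟ lookup m k

coloredPermutations : ∀ {n} (m r : Vec ℕ n) → List (Vec (Letter r) (Vec.sum m))
coloredPermutations m r = List.filter (hasContent? m) (words r (Vec.sum m))

-- The letter k^c, as the pair (color , letter), so that the order on
-- letters is lexicographic.

Key : Set
Key = ℕ × ℕ

key : ∀ {n} {r : Vec ℕ n} → Letter r → Key
key (k ⟨ c ⟩) = toℕ c , toℕ k

infix 4 _≺_ _≺?_

_≺_ : Rel Key 0ℓ
_≺_ = ×-Lex _≡_ ℕ._<_ ℕ._<_

_≺?_ : Decidable _≺_
_≺?_ = ×-decidable ℕ._≟_ ℕ._<?_ ℕ._<?_

descents : ∀ {l} → Vec Key l → ℕ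
descents []           = 0
descents (_ ∷ [])     = 0
descents (a ∷ b ∷ ks) = (if does (b ≺? a) then 1 else 0) ℕ.+ descents (b ∷ ks)

-- The appended key is that of the letter (n+1)^1.

des : ∀ {n l} {r : Vec ℕ n} → Vec (Letter r) l → ℕ
des {n} w = descents (Vec.map key w ∷ʳ (0 , n))

coloredEulerian : ∀ {n} (m r : Vec ℕ n) → Series
coloredEulerian m r =
  List.foldr _⊕_ 0ₛ (List.map (λ w → x^ des w) (coloredPermutations m r))

------------------------------------------------------------------------
-- Ehrhart series and h*-polynomials

HasCardinality : ∀ {A : Set} → Pred A 0ℓ → ℕ → Set
HasCardinality {A} P c =
  Σ[ as ∈ List A ] Unique as × (∀ a → (a ∈ as) ⇔ P a) × List.length as ≡ c

-- Subsets of ℝᴺ are represented by their rational points.  This does not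
-- affect the lattice points of tP for t > 0: if z ∈ ℤᴺ and z = t x, then x
-- is rational.

Region : ℕ → Set₁
Region N = Pred (Vec ℚ N) 0ℓ

LatticePoint : ∀ {N} → ℕ → Region N → Pred (Vec ℤ N) 0ℓ
LatticePoint t P z =
  ∃[ x ] P x × Vec.map (ℚ._/ 1) z ≡ Vec.map ((+ t ℚ./ 1) ℚ.*_) x

record IsEhrhart {N} (P : Region N) (L : ℕ → ℕ) : Set where
  field
    constantTerm : L 0 ≡ 1
    counts       : ∀ t .{{_ : NonZero t}} → HasCardinality (LatticePoint t P) (L t)

-- Here d is the dimension of the lattice polytope P.

record IsHStar {N} (d : ℕ) (P : Region N) (h : Series) : Set where
  field
    polynomial : IsPolynomial h
    ehrhart    : ℕ → ℕ
    isEhrhart  : IsEhrhart P ehrhart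
    equation   : (λ t → + ehrhart t) ⊛ 1-x ^ₛ suc d ≗ h

------------------------------------------------------------------------
-- Lecture hall simplices and s-Eulerian polynomials

-- The sequence (s₁, s₂, …) is indexed from 0.

scaled : (s : ℕ → ℕ) .{{_ : ∀ {i} → NonZero (s i)}} → ∀ {N} → Vec ℚ N → Vec ℚ N
scaled s x = Vec.tabulate λ i → lookup x i ℚ.* (1ℤ ℚ./ s (toℕ i))

lectureHallSimplex : (s : ℕ → ℕ) .{{_ : ∀ {i} → NonZero (s i)}} → ∀ N → Region N
lectureHallSimplex s N x = Linked ℚ._≤_ (0ℚ ∷ (scaled s x ∷ʳ 1ℚ))

-- Since every sᵢ is positive, the simplex is full-dimensional.

IsEulerianPolynomial : (s : ℕ → ℕ) .{{_ : ∀ {i} → NonZero (s i)}} → ℕ → Pred Series 0ℓ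
IsEulerianPolynomial s N = IsHStar N (lectureHallSimplex s N)

IsSEulerian : Pred Series 0ℓ
IsSEulerian f =
  Σ[ s ∈ (ℕ → ℕ) ] Σ[ pos ∈ (∀ {i} → NonZero (s i)) ] ∃[ N ]
    NonZero N × IsEulerianPolynomial s {{pos}} N f

------------------------------------------------------------------------
-- The vectors (1,…,1), (2,…,2) and (2,…,2,1)

data OnesOrTwos : ∀ {n} → Vec ℕ n → Set where
  ones    : ∀ {n} → OnesOrTwos (Vec.replicate n 1)
  twos    : ∀ {n} → OnesOrTwos (Vec.replicate n 2)
  twosOne : ∀ {n} → OnesOrTwos (Vec.replicate n 2 ∷ʳ 1)

{-# OPTIONS --safe #-}
module Submission where

-- Replace each letter of a colored permutation by a place in t + 1 consecutive copies of
-- the alphabet, listed so that the places move weakly in one direction: a descent forces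
-- a jump to another copy, so a word with d descents has generating function
-- x^d / (1-x)^(1+|m|) in t.  Read place by place, the same configurations are multisets
-- of places with prescribed content, and letter k occurs at rt + 1 places.  Hence
-- the coloredEulerian series is (1-x)^(1+|m|) Σₜ Πₖ multichoose (rt + 1) mₖ xᵗ.
--
-- Take sᵢ = r σᵢ with σ = 1,2,3,… when all mₖ = 1, and σ = 1,1,3,2,5,3,7,4,… otherwise.
-- The t-th dilation of the simplex of s has the lattice points of the rt-th dilation for
-- σ.  The number of these whose last coordinate is at most σ_N q + p with 0 ≤ p ≤ σ_N has a
-- closed form, found by induction on N and p: increasing p by one adds the points
-- with a fixed last coordinate, which are counted one dimension lower.  With
-- b = multichoose (q+1) 2 and b′ = multichoose (q+2) 2 it is
--   (q+1)^(N-p) (q+2)^p                           for σ = 1,2,3,…,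
--   b^(i-p) b′^p                                  for the second σ and N = 2i,
--   (q+1) b^(i-a) b′^a  or  (q+2) b^(i-a) b′^a    for N = 2i+1 and p = 2a or 2a+1.

open import Defs
open import Data.Bool.Base as Bool using (if_then_else_; true; false)
open import Data.Fin.Base as Fin using (Fin; zero; suc; toℕ)
import Data.Fin.Properties as Fin
open import Data.Integer.Base as ℤ using (ℤ; 0ℤ; 1ℤ; -1ℤ)
import Data.Integer.Properties as ℤ
open import Data.Integer.Tactic.RingSolver using () renaming (solve-∀ to ℤ-solve-∀)
open import Data.List.Base as List using (List; []; _∷_; _++_; upTo; cartesianProduct)
open import Data.List.Membership.Propositional using (_∈_; _∉_)
open import Data.List.Membership.Propositional.Properties
open import Data.List.Properties using (++-assoc; ++-identityʳ; length-++; length-map; length-upTo)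
open import Data.List.Relation.Unary.All as All using (All; []; _∷_)
import Data.List.Relation.Unary.All.Properties as All
open import Data.List.Relation.Unary.AllPairs as AllPairs using (AllPairs; []; _∷_)
import Data.List.Relation.Unary.AllPairs.Properties as AllPairs
open import Data.List.Relation.Unary.Any using (here; there)
open import Data.List.Relation.Unary.Unique.Propositional using (Unique)
import Data.List.Relation.Unary.Unique.Propositional.Properties as Unique
open import Data.Nat.Base as ℕ
  using (ℕ; zero; suc; pred; NonZero; _+_; _*_; _^_; _≤_; _<_; z≤n; s≤s; s≤s⁻¹; ⌊_/2⌋)
open import Data.Nat.ListAction using () renaming (sum to sumₗ)
import Data.Nat.Properties as ℕ
open import Data.Nat.Tactic.RingSolver using () renaming (solve-∀ to ℕ-solve-∀)
open import Data.Product.Base using (∃; ∃₂; ∃-syntax; _×_; _,_; proj₁; proj₂)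
open import Data.Product.Properties using (≡-dec)
open import Data.Product.Relation.Binary.Lex.Strict using (×-transitive; ×-irreflexive)
open import Data.Rational.Base as ℚ using (ℚ; 0ℚ; 1ℚ)
import Data.Rational.Properties as ℚ
open import Data.Rational.Unnormalised.Base as ℚᵘ using (mkℚᵘ)
import Data.Rational.Unnormalised.Properties as ℚᵘ
open import Data.Sum.Base as Sum using (_⊎_; inj₁; inj₂)
open import Data.Vec.Base as Vec
  using (Vec; []; _∷_; _∷ʳ_; lookup; replicate; tabulate; initLast; updateAt)
import Data.Vec.Properties as Vec
import Data.Vec.Relation.Unary.All as VecAll
import Data.Vec.Relation.Unary.All.Properties as VecAll
open import Data.Vec.Relation.Unary.Linked as Linked using (Linked; [-]; _∷_)
import Data.Vec.Relation.Unary.Linked.Properties as Linked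
open import Function.Base using (_∘_)
open import Function.Bundles using (_⇔_; mk⇔; module Equivalence)
open import Function.Properties.Equivalence using () renaming (sym to ⇔-sym)
open import Level using (0ℓ)
open import Relation.Binary.Core using (Rel)
open import Relation.Binary.Definitions using (DecidableEquality)
open import Relation.Binary.PropositionalEquality
open import Relation.Nullary using (¬_; Dec; does; yes; no; contradiction)
open import Relation.Nullary.Decidable using (dec-true; dec-false; does-⇔)
open import Relation.Unary using (Pred)
import Relation.Unary as Unary

open import Algebra.Properties.CommutativeMonoid.Sum ℕ.*-1-commutativeMonoid
  using () renaming (sum to ∏; sum-cong-≗ to ∏-cong)
open import Algebra.Properties.Semiring.Sum ℤ.+-*-semiring
  using (sum; sum-cong-≗; sum-replicate-zero)

open Equivalence using (to; from)
open Letter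
open ≡-Reasoning

-- Power series and backward differences

shift : Series → Series
shift f zero    = 0ℤ
shift f (suc j) = f j

Δ : Series → Series
Δ f j = f j ℤ.- shift f j

Δ^ : ℕ → Series → Series
Δ^ zero    f = f
Δ^ (suc k) f = Δ (Δ^ k f)

shift-cong : ∀ {f g} → f ≗ g → shift f ≗ shift g
shift-cong p zero    = refl
shift-cong p (suc j) = p j

Δ-cong : ∀ {f g} → f ≗ g → Δ f ≗ Δ g
Δ-cong p j = cong₂ ℤ._-_ (p j) (shift-cong p j)

Δ^-cong : ∀ k {f g} → f ≗ g → Δ^ k f ≗ Δ^ k g
Δ^-cong zero    p = p
Δ^-cong (suc k) p = Δ-cong (Δ^-cong k p)

Δ-shift : ∀ f → Δ (shift f) ≗ shift (Δ f)
Δ-shift f zero          = refl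
Δ-shift f (suc zero)    = refl
Δ-shift f (suc (suc j)) = refl

Δ^-shift : ∀ k f → Δ^ k (shift f) ≗ shift (Δ^ k f)
Δ^-shift zero    f j = refl
Δ^-shift (suc k) f j = trans (Δ-cong (Δ^-shift k f) j) (Δ-shift (Δ^ k f) j)

-- `Δ^` peels off the outermost difference, while the induction over a word needs the innermost one.
Δ^-suc : ∀ k f → Δ^ (suc k) f ≗ Δ^ k (Δ f)
Δ^-suc zero    f j = refl
Δ^-suc (suc k) f   = Δ-cong (Δ^-suc k f)

Δ-⊕ : ∀ f g → Δ (f ⊕ g) ≗ Δ f ⊕ Δ g
Δ-⊕ f g zero    = lemma (f 0) (g 0)
  where
  lemma : ∀ a b → (a ℤ.+ b) ℤ.- 0ℤ ≡ (a ℤ.- 0ℤ) ℤ.+ (b ℤ.- 0ℤ)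
  lemma = ℤ-solve-∀
Δ-⊕ f g (suc j) = lemma (f (suc j)) (g (suc j)) (f j) (g j)
  where
  lemma : ∀ a b c d → (a ℤ.+ b) ℤ.- (c ℤ.+ d) ≡ (a ℤ.- c) ℤ.+ (b ℤ.- d)
  lemma = ℤ-solve-∀

Δ^-⊕ : ∀ k f g → Δ^ k (f ⊕ g) ≗ Δ^ k f ⊕ Δ^ k g
Δ^-⊕ zero    f g j = refl
Δ^-⊕ (suc k) f g j = trans (Δ-cong (Δ^-⊕ k f g) j) (Δ-⊕ (Δ^ k f) (Δ^ k g) j)

Δ^-0ₛ : ∀ k → Δ^ k 0ₛ ≗ 0ₛ
Δ^-0ₛ zero    j       = refl
Δ^-0ₛ (suc k) zero    = cong (ℤ._- 0ℤ) (Δ^-0ₛ k 0)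
Δ^-0ₛ (suc k) (suc j) = cong₂ ℤ._-_ (Δ^-0ₛ k (suc j)) (Δ^-0ₛ k j)

⊛-cong : ∀ f {g h} → g ≗ h → f ⊛ g ≗ f ⊛ h
⊛-cong f p j = sum-cong-≗ {suc j} λ i → cong (f (toℕ i) ℤ.*_) (p (j ℕ.∸ toℕ i))

⊛-identityʳ : ∀ f → f ⊛ x^ 0 ≗ f
⊛-identityʳ f zero    = trans (ℤ.+-identityʳ _) (ℤ.*-identityʳ (f 0))
⊛-identityʳ f (suc j) = begin
  f 0 ℤ.* 0ℤ ℤ.+ ((λ i → f (suc i)) ⊛ x^ 0) j
    ≡⟨ cong₂ ℤ._+_ (ℤ.*-zeroʳ (f 0)) (⊛-identityʳ (λ i → f (suc i)) j) ⟩
  0ℤ ℤ.+ f (suc j)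
    ≡⟨ ℤ.+-identityˡ _ ⟩
  f (suc j) ∎

1-x-⊛ : ∀ g → 1-x ⊛ g ≗ Δ g
1-x-⊛ g zero    = lemma (g 0)
  where
  lemma : ∀ a → 1ℤ ℤ.* a ℤ.+ 0ℤ ≡ a ℤ.- 0ℤ
  lemma = ℤ-solve-∀
1-x-⊛ g (suc j) = begin
  1ℤ ℤ.* g (suc j) ℤ.+ (-1ℤ ℤ.* g j ℤ.+ rest)
    ≡⟨ cong (λ z → 1ℤ ℤ.* g (suc j) ℤ.+ (-1ℤ ℤ.* g j ℤ.+ z)) (sum-replicate-zero j) ⟩
  1ℤ ℤ.* g (suc j) ℤ.+ (-1ℤ ℤ.* g j ℤ.+ 0ℤ)
    ≡⟨ lemma (g (suc j)) (g j) ⟩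
  g (suc j) ℤ.- g j ∎
  where
  rest : ℤ
  rest = sum {j} λ _ → 0ℤ
  lemma : ∀ a b → 1ℤ ℤ.* a ℤ.+ (-1ℤ ℤ.* b ℤ.+ 0ℤ) ≡ a ℤ.- b
  lemma = ℤ-solve-∀

-- Moving the difference out of the right factor avoids associativity and commutativity of `_⊛_`.
-- The induction strips the first coefficient of `f`; indices 0 and 1 are separate because `shift`
-- has its own value at 0.
⊛-Δ : ∀ f g → f ⊛ Δ g ≗ Δ (f ⊛ g)
⊛-Δ f g zero = lemma (f 0) (g 0)
  where
  lemma : ∀ a b → a ℤ.* (b ℤ.- 0ℤ) ℤ.+ 0ℤ ≡ (a ℤ.* b ℤ.+ 0ℤ) ℤ.- 0ℤ
  lemma = ℤ-solve-∀
⊛-Δ f g (suc zero) = lemma (f 0) (f 1) (g 0) (g 1)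
  where
  lemma : ∀ a a′ b b′ → a ℤ.* (b′ ℤ.- b) ℤ.+ (a′ ℤ.* (b ℤ.- 0ℤ) ℤ.+ 0ℤ) ≡
                        (a ℤ.* b′ ℤ.+ (a′ ℤ.* b ℤ.+ 0ℤ)) ℤ.- (a ℤ.* b ℤ.+ 0ℤ)
  lemma = ℤ-solve-∀
⊛-Δ f g (suc (suc j)) = begin
  f 0 ℤ.* (g (2 ℕ.+ j) ℤ.- g (suc j)) ℤ.+ (tail ⊛ Δ g) (suc j)
    ≡⟨ cong (λ z → f 0 ℤ.* (g (2 ℕ.+ j) ℤ.- g (suc j)) ℤ.+ z) (⊛-Δ tail g (suc j)) ⟩
  f 0 ℤ.* (g (2 ℕ.+ j) ℤ.- g (suc j)) ℤ.+ ((tail ⊛ g) (suc j) ℤ.- (tail ⊛ g) j)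
    ≡⟨ lemma (f 0) (g (2 ℕ.+ j)) (g (suc j)) ((tail ⊛ g) (suc j)) ((tail ⊛ g) j) ⟩
  (f 0 ℤ.* g (2 ℕ.+ j) ℤ.+ (tail ⊛ g) (suc j)) ℤ.- (f 0 ℤ.* g (suc j) ℤ.+ (tail ⊛ g) j) ∎
  where
  tail : Series
  tail i = f (suc i)
  lemma : ∀ a b b′ c c′ → a ℤ.* (b ℤ.- b′) ℤ.+ (c ℤ.- c′) ≡ (a ℤ.* b ℤ.+ c) ℤ.- (a ℤ.* b′ ℤ.+ c′)
  lemma = ℤ-solve-∀

⊛-1-x^ : ∀ k f → f ⊛ 1-x ^ₛ k ≗ Δ^ k f
⊛-1-x^ zero    f   = ⊛-identityʳ f
⊛-1-x^ (suc k) f j = begin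
  (f ⊛ 1-x ^ₛ suc k) j     ≡⟨ ⊛-cong f (1-x-⊛ (1-x ^ₛ k)) j ⟩
  (f ⊛ Δ (1-x ^ₛ k)) j     ≡⟨ ⊛-Δ f (1-x ^ₛ k) j ⟩
  Δ (f ⊛ 1-x ^ₛ k) j       ≡⟨ Δ-cong (⊛-1-x^ k f) j ⟩
  Δ^ (suc k) f j           ∎

shift-x^ : ∀ k → shift (x^ k) ≗ x^ suc k
shift-x^ k zero    = refl
shift-x^ k (suc j) = refl

Σₛ : ∀ {A : Set} → List A → (A → Series) → Series
Σₛ as f = List.foldr _⊕_ 0ₛ (List.map f as)

Δ^-Σₛ : ∀ {A : Set} k (as : List A) {f g : A → Series} → (∀ a → Δ^ k (f a) ≗ g a) →
        Δ^ k (Σₛ as f) ≗ Σₛ as g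
Δ^-Σₛ k []       p j = Δ^-0ₛ k j
Δ^-Σₛ k (a ∷ as) {f} p j =
  trans (Δ^-⊕ k (f a) (Σₛ as f) j) (cong₂ ℤ._+_ (p a j) (Δ^-Σₛ k as p j))

x^-polynomial : ∀ k → IsPolynomial (x^ k)
x^-polynomial k = k , vanish
  where
  vanish : ∀ j → k ℕ.< j → (x^ k) j ≡ 0ℤ
  vanish j k<j with k ℕ.≡ᵇ j in eq
  ... | false = refl
  ... | true  with () ← ℕ.<⇒≢ k<j (ℕ.≡ᵇ⇒≡ k j (subst Bool.T (sym eq) _))

⊕-polynomial : ∀ {f g} → IsPolynomial f → IsPolynomial g → IsPolynomial (f ⊕ g)
⊕-polynomial (D , p) (E , q) =
  D ℕ.⊔ E , λ j lt → cong₂ ℤ._+_ (p j (ℕ.≤-<-trans (ℕ.m≤m⊔n D E) lt))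
                                 (q j (ℕ.≤-<-trans (ℕ.m≤n⊔m D E) lt))

Σₛ-polynomial : ∀ {A : Set} (as : List A) {f} → (∀ a → IsPolynomial (f a)) →
                IsPolynomial (Σₛ as f)
Σₛ-polynomial []       p = 0 , λ _ _ → refl
Σₛ-polynomial (a ∷ as) p = ⊕-polynomial (p a) (Σₛ-polynomial as p)

-- Spreading words over lists of places

if-intro : ∀ {P A : Set} (d : Dec P) {a b c : A} →
           (P → a ≡ b) → (¬ P → a ≡ c) → a ≡ (if does d then b else c)
if-intro (yes p) f g = f p
if-intro (no ¬p) f g = g ¬p

_≟ₖ_ : DecidableEquality Key
_≟ₖ_ = ≡-dec ℕ._≟_ ℕ._≟_

≺-irrefl : ∀ {a} → ¬ a ≺ a
≺-irrefl = ×-irreflexive {_≈₁_ = _≡_} {_<₁_ = ℕ._<_} {_≈₂_ = _≡_} {_<₂_ = ℕ._<_}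
                       ℕ.<-irrefl ℕ.<-irrefl (refl , refl)

≺-trans : ∀ {a b c} → a ≺ b → b ≺ c → a ≺ c
≺-trans = ×-transitive {_<₁_ = ℕ._<_} {_<₂_ = ℕ._<_} isEquivalence ℕ.<-resp₂-≡ ℕ.<-trans ℕ.<-trans

-- The number of ways to spread the word u₁ u₂ … weakly rightwards over
-- the places of the list, each letter on a place carrying that letter.

chains : ∀ {l} → Vec Key l → List Key → ℕ
chains []      _        = 1
chains (u ∷ w) []       = 0
chains (u ∷ w) (v ∷ vs) =
  chains (u ∷ w) vs + (if does (v ≟ₖ u) then chains w (v ∷ vs) else 0)

module _ {l} {w : Vec Key l} where

  chains-hit : ∀ u vs → chains (u ∷ w) (u ∷ vs) ≡ chains (u ∷ w) vs + chains w (u ∷ vs)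
  chains-hit u vs rewrite dec-true (u ≟ₖ u) refl = refl

  chains-skip : ∀ {u vs} → u ∉ vs → ∀ R → chains (u ∷ w) (vs ++ R) ≡ chains (u ∷ w) R
  chains-skip {vs = []}         u∉  R = refl
  chains-skip {u} {vs = v ∷ vs} u∉  R
    rewrite dec-false (v ≟ₖ u) (λ { refl → u∉ (here refl) }) =
    trans (ℕ.+-identityʳ _) (chains-skip (u∉ ∘ there) R)

  -- The block holds `u` exactly once, so the first letter either goes past the block or takes that
  -- one place, after which the places before it are lost.
  chains-split : ∀ us {u vs} → u ∉ us → u ∉ vs → ∀ R →
                 chains (u ∷ w) ((us ++ u ∷ vs) ++ R) ≡
                 chains (u ∷ w) R + chains w (u ∷ vs ++ R)
  chains-split us {u} {vs} u∉us u∉vs R = begin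
    chains (u ∷ w) ((us ++ u ∷ vs) ++ R)                 ≡⟨ cong (chains (u ∷ w)) (++-assoc us (u ∷ vs) R) ⟩
    chains (u ∷ w) (us ++ u ∷ vs ++ R)                   ≡⟨ chains-skip u∉us (u ∷ vs ++ R) ⟩
    chains (u ∷ w) (u ∷ vs ++ R)                         ≡⟨ chains-hit u (vs ++ R) ⟩
    chains (u ∷ w) (vs ++ R) + chains w (u ∷ vs ++ R)    ≡⟨ cong (_+ chains w (u ∷ vs ++ R)) (chains-skip u∉vs R) ⟩
    chains (u ∷ w) R + chains w (u ∷ vs ++ R)            ∎

Sorted : List Key → Set
Sorted = AllPairs _≺_

sorted-∉ˡ : ∀ us {x u vs} → Sorted (us ++ u ∷ vs) → ¬ x ≺ u → x ∉ us
sorted-∉ˡ (_ ∷ us) (p ∷ _) x⊀u (here refl) = x⊀u (All.head (All.++⁻ʳ us p))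
sorted-∉ˡ (_ ∷ us) (_ ∷ s) x⊀u (there i)   = sorted-∉ˡ us s x⊀u i

sorted-∉ʳ : ∀ us {x u vs} → Sorted (us ++ u ∷ vs) → ¬ u ≺ x → x ∉ vs
sorted-∉ʳ []       (p ∷ _) u⊀x i = u⊀x (All.lookup p i)
sorted-∉ʳ (_ ∷ us) (_ ∷ s) u⊀x i = sorted-∉ʳ us s u⊀x i

module _ {u B} (sorted : Sorted B) (u∈B : u ∈ B) (R : List Key) where

  chains-sorted-[] : chains (u ∷ []) (B ++ R) ≡ chains (u ∷ []) R + 1
  chains-sorted-[] with us , vs , refl ← ∈-∃++ u∈B =
    chains-split us (sorted-∉ˡ us sorted ≺-irrefl) (sorted-∉ʳ us sorted ≺-irrefl) R

  -- With `u` placed, `x` sees only the places from `u` onwards. If `x ≺ u`, the block has no place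
  -- for `x` there and the word continues in `R`; otherwise no place before `u` carries `x`, so the
  -- whole block can be restored. This is how a descent forces a jump.
  chains-sorted-∷ : ∀ {l} x {w : Vec Key l} →
                    chains (u ∷ x ∷ w) (B ++ R) ≡
                    chains (u ∷ x ∷ w) R +
                    (if does (x ≺? u) then chains (x ∷ w) R else chains (x ∷ w) (B ++ R))
  chains-sorted-∷ x {w} with us , vs , refl ← ∈-∃++ u∈B =
    trans (chains-split us (sorted-∉ˡ us sorted ≺-irrefl) (sorted-∉ʳ us sorted ≺-irrefl) R)
          (cong (chains (u ∷ x ∷ w) R +_) rest)
    where
    rest : chains (x ∷ w) (u ∷ vs ++ R) ≡
           (if does (x ≺? u) then chains (x ∷ w) R else chains (x ∷ w) ((us ++ u ∷ vs) ++ R))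
    rest = if-intro (x ≺? u)
      (λ x≺u → chains-skip {vs = u ∷ vs} (λ
        { (here refl) → ≺-irrefl x≺u
        ; (there i)   → sorted-∉ʳ us sorted (≺-irrefl ∘ ≺-trans x≺u) i }) R)
      (λ x⊀u → sym (trans (cong (chains (x ∷ w)) (++-assoc us (u ∷ vs) R))
                          (chains-skip (sorted-∉ˡ us sorted x⊀u) (u ∷ vs ++ R))))

sorted-upTo : ∀ n → AllPairs ℕ._<_ (upTo n)
sorted-upTo n = AllPairs.applyUpTo⁺₁ _ n λ i<j _ → i<j

sorted-cartesianProduct : ∀ {xs ys} → AllPairs ℕ._<_ xs → AllPairs ℕ._<_ ys →
                          Sorted (cartesianProduct xs ys)
sorted-cartesianProduct []                       _  = []
sorted-cartesianProduct {x ∷ xs} {ys} (x< ∷ xs<) s =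
  AllPairs.++⁺ (AllPairs.map⁺ (AllPairs.map (λ y<z → inj₂ (refl , y<z)) s))
               (sorted-cartesianProduct xs< s)
               (All.map⁺ (All.universal row ys))
  where
  row : ∀ y → All ((x , y) ≺_) (cartesianProduct xs ys)
  row y = All.tabulate λ i → inj₁ (All.lookup x< (proj₁ (∈-cartesianProduct⁻ xs ys i)))

-- Levels of the alphabet and the generating function of one word

module _ (r n : ℕ) where

  block : List Key
  block = cartesianProduct (upTo r) (upTo n)

  -- The last level is cut short because a letter in it may not exceed the appended key (0 , n).

  levels : ℕ → List Key
  levels zero    = cartesianProduct (upTo 1) (upTo n)
  levels (suc t) = block ++ levels t

  levelCount : ∀ {l} → Vec Key l → Series
  levelCount w t = ℤ.+ chains w (levels t)

  ∈-block : ∀ {u} → proj₁ u ℕ.< r → proj₂ u ℕ.< n → u ∈ block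
  ∈-block p q = ∈-cartesianProduct⁺ (∈-upTo⁺ p) (∈-upTo⁺ q)

  sorted-block : Sorted block
  sorted-block = sorted-cartesianProduct (sorted-upTo r) (sorted-upTo n)

  sorted-level₀ : Sorted (levels 0)
  sorted-level₀ = sorted-cartesianProduct (sorted-upTo 1) (sorted-upTo n)

  ∈-level₀⁻ : ∀ {u} → u ∈ levels 0 → proj₁ u ≡ 0
  ∈-level₀⁻ i with s≤s z≤n ← ∈-upTo⁻ {1} (proj₁ (∈-cartesianProduct⁻ (upTo 1) (upTo n) i)) = refl

  following : ∀ {l} → Vec Key l → Key
  following w = Vec.head (w ∷ʳ (0 , n))

  chains-levels : ∀ {l} {u} (w : Vec Key l) → u ∈ block → ∀ t →
                  chains (u ∷ w) (levels (suc t)) ≡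
                  chains (u ∷ w) (levels t) +
                  (if does (following w ≺? u) then chains w (levels t) else chains w (levels (suc t)))
  chains-levels {u = u} [] u∈ t =
    trans (chains-sorted-[] sorted-block u∈ (levels t))
          (cong (chains (u ∷ []) (levels t) +_)
                -- The empty rest of the word can be spread in one way over any list, so both
                -- branches are 1.
                (if-intro ((0 , n) ≺? u) (λ _ → refl) (λ _ → refl)))
  chains-levels (x ∷ w) u∈ t = chains-sorted-∷ sorted-block u∈ (levels t) x

  chains-level₀-∈ : ∀ {l} {k} (w : Vec Key l) → k ℕ.< n →
                    chains ((0 , k) ∷ w) (levels 0) ≡
                    (if does (following w ≺? (0 , k)) then 0 else chains w (levels 0))
  chains-level₀-∈ {k = k} w k<n =
    subst (λ L → chains ((0 , k) ∷ w) L ≡ (if does (following w ≺? (0 , k)) then 0 else chains w L))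
          (++-identityʳ (levels 0)) (lemma w)
    where
    k∈ : (0 , k) ∈ levels 0
    k∈ = ∈-cartesianProduct⁺ (∈-upTo⁺ {1} (s≤s z≤n)) (∈-upTo⁺ k<n)
    lemma : ∀ {l} (w : Vec Key l) →
            chains ((0 , k) ∷ w) (levels 0 ++ []) ≡
            (if does (following w ≺? (0 , k)) then 0 else chains w (levels 0 ++ []))
    lemma []      = trans (chains-sorted-[] sorted-level₀ k∈ [])
                          (if-intro ((0 , n) ≺? (0 , k))
                            -- The appended key exceeds every letter of color 0, so there is no
                            -- descent here.
                            (λ { (inj₂ (_ , n<k)) → contradiction k<n (ℕ.<-asym n<k) })
                            (λ _ → refl))
    lemma (x ∷ w) = chains-sorted-∷ sorted-level₀ k∈ [] x

  chains-level₀-∉ : ∀ {l} {u} (w : Vec Key l) → proj₁ u ≢ 0 → chains (u ∷ w) (levels 0) ≡ 0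
  chains-level₀-∉ {u = u} w u≢ =
    trans (cong (chains (u ∷ w)) (sym (++-identityʳ (levels 0))))
          (chains-skip (u≢ ∘ ∈-level₀⁻) [])

  -- A letter of nonzero color has no place at level 0. If no descent follows it, the next letter
  -- has nonzero color as well and both sides vanish; before the appended key, of color 0, there
  -- always is a descent.
  chains-level₀ : ∀ {l} u (w : Vec Key l) → proj₂ u ℕ.< n →
                  chains (u ∷ w) (levels 0) ≡
                  (if does (following w ≺? u) then 0 else chains w (levels 0))
  chains-level₀ (zero , k)    w       k<n = chains-level₀-∈ w k<n
  chains-level₀ (suc c , k)   []      k<n = chains-level₀-∉ [] λ ()
  chains-level₀ u@(suc c , k) (x ∷ w) k<n =
    if-intro (x ≺? u)
      (λ _ → chains-level₀-∉ (x ∷ w) λ ())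
      (λ x⊀u → trans (chains-level₀-∉ (x ∷ w) λ ())
                     (sym (chains-level₀-∉ w λ { refl → x⊀u (inj₁ (s≤s z≤n)) })))

  shiftIf : ∀ {P : Set} → Dec P → Series → Series
  shiftIf d f = if does d then shift f else f

  -- The difference counts the spreadings with `u` in the first copy of the alphabet. After a
  -- descent the remaining word starts one level later, which multiplies its series by x.
  Δ-levelCount : ∀ {l} {u} (w : Vec Key l) → proj₁ u ℕ.< r → proj₂ u ℕ.< n →
                 Δ (levelCount (u ∷ w)) ≗ shiftIf (following w ≺? u) (levelCount w)
  Δ-levelCount {u = u} w c<r k<n zero = begin
    levelCount (u ∷ w) 0 ℤ.- 0ℤ
      ≡⟨ ℤ.+-identityʳ _ ⟩
    levelCount (u ∷ w) 0
      ≡⟨ cong ℤ.+_ (chains-level₀ u w k<n) ⟩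
    ℤ.+ (if does (following w ≺? u) then 0 else chains w (levels 0))
      ≡⟨ move (does (following w ≺? u)) ⟩
    shiftIf (following w ≺? u) (levelCount w) 0 ∎
    where
    move : ∀ b → ℤ.+ (if b then 0 else chains w (levels 0)) ≡
                 (if b then shift (levelCount w) else levelCount w) 0
    move true  = refl
    move false = refl
  Δ-levelCount {u = u} w c<r k<n (suc t) = begin
    levelCount (u ∷ w) (suc t) ℤ.- levelCount (u ∷ w) t
      ≡⟨ cong (λ a → ℤ.+ a ℤ.- levelCount (u ∷ w) t) (chains-levels w (∈-block c<r k<n) t) ⟩
    ℤ.+ (chains (u ∷ w) (levels t) + rest) ℤ.- levelCount (u ∷ w) t
      ≡⟨ cong (λ a → ℤ.+ a ℤ.- levelCount (u ∷ w) t) (ℕ.+-comm _ rest) ⟩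
    (ℤ.+ rest ℤ.+ levelCount (u ∷ w) t) ℤ.- levelCount (u ∷ w) t
      ≡⟨ ℤ.+-assoc (ℤ.+ rest) (levelCount (u ∷ w) t) (ℤ.- levelCount (u ∷ w) t) ⟩
    ℤ.+ rest ℤ.+ (levelCount (u ∷ w) t ℤ.- levelCount (u ∷ w) t)
      ≡⟨ cong (ℤ._+_ (ℤ.+ rest)) (ℤ.+-inverseʳ (levelCount (u ∷ w) t)) ⟩
    ℤ.+ rest ℤ.+ 0ℤ
      ≡⟨ ℤ.+-identityʳ _ ⟩
    ℤ.+ rest
      ≡⟨ move (does (following w ≺? u)) ⟩
    shiftIf (following w ≺? u) (levelCount w) (suc t) ∎
    where
    rest : ℕ
    rest = if does (following w ≺? u) then chains w (levels t) else chains w (levels (suc t))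
    move : ∀ b → ℤ.+ (if b then chains w (levels t) else chains w (levels (suc t))) ≡
                 (if b then shift (levelCount w) else levelCount w) (suc t)
    move true  = refl
    move false = refl

  Δ^-shiftIf : ∀ {P : Set} (d : Dec P) j {f k} → Δ^ j f ≗ x^ k →
               Δ^ j (shiftIf d f) ≗ x^ ((if does d then 1 else 0) + k)
  Δ^-shiftIf (no _)  j     p = p
  Δ^-shiftIf (yes _) j {f} {k} p i =
    trans (Δ^-shift j f i) (trans (shift-cong p i) (shift-x^ k i))

  descents-∷ : ∀ {l} u (w : Vec Key l) →
               descents ((u ∷ w) ∷ʳ (0 , n)) ≡
               (if does (following w ≺? u) then 1 else 0) + descents (w ∷ʳ (0 , n))
  descents-∷ u []      = refl
  descents-∷ u (_ ∷ _) = refl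

  -- Each letter uses up one difference and leaves a factor x if it is a descent. The remaining
  -- difference turns the constant series 1, 1, ... of the empty word into 1, so the series of a
  -- word is x^des / (1-x)^(l+1).
  Δ^-levelCount : ∀ {l} {w : Vec Key l} → VecAll.All (λ u → proj₁ u ℕ.< r × proj₂ u ℕ.< n) w →
                  Δ^ (suc l) (levelCount w) ≗ x^ descents (w ∷ʳ (0 , n))
  Δ^-levelCount VecAll.[] zero    = refl
  Δ^-levelCount VecAll.[] (suc j) = refl
  Δ^-levelCount {suc l} {u ∷ w} ((c<r , k<n) VecAll.∷ ps) j = begin
    Δ^ (suc (suc l)) (levelCount (u ∷ w)) j
      ≡⟨ Δ^-suc (suc l) (levelCount (u ∷ w)) j ⟩
    Δ^ (suc l) (Δ (levelCount (u ∷ w))) j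
      ≡⟨ Δ^-cong (suc l) (Δ-levelCount w c<r k<n) j ⟩
    Δ^ (suc l) (shiftIf (following w ≺? u) (levelCount w)) j
      ≡⟨ Δ^-shiftIf (following w ≺? u) (suc l) (Δ^-levelCount ps) j ⟩
    (x^ ((if does (following w ≺? u) then 1 else 0) + descents (w ∷ʳ (0 , n)))) j
      ≡⟨ cong (λ d → (x^ d) j) (descents-∷ u w) ⟨
    (x^ descents ((u ∷ w) ∷ʳ (0 , n))) j ∎

-- Counting chains by content

sumOn : ∀ {A : Set} → List A → (A → ℕ) → ℕ
sumOn as f = sumₗ (List.map f as)

module _ {A : Set} where

  sumOn-cong : ∀ (as : List A) {f g} → f ≗ g → sumOn as f ≡ sumOn as g
  sumOn-cong []       p = refl
  sumOn-cong (a ∷ as) p = cong₂ _+_ (p a) (sumOn-cong as p)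

  sumOn-zero : ∀ (as : List A) {f} → (∀ a → f a ≡ 0) → sumOn as f ≡ 0
  sumOn-zero []       p = refl
  sumOn-zero (a ∷ as) p = cong₂ _+_ (p a) (sumOn-zero as p)

  sumOn-+ : ∀ (as : List A) f g → sumOn as (λ a → f a + g a) ≡ sumOn as f + sumOn as g
  sumOn-+ []       f g = refl
  sumOn-+ (a ∷ as) f g = trans (cong (f a + g a +_) (sumOn-+ as f g))
                               (lemma (f a) (g a) (sumOn as f) (sumOn as g))
    where
    lemma : ∀ a b c d → (a + b) + (c + d) ≡ (a + c) + (b + d)
    lemma = ℕ-solve-∀

  sumOn-++ : ∀ (as bs : List A) f → sumOn (as ++ bs) f ≡ sumOn as f + sumOn bs f
  sumOn-++ []       bs f = refl
  sumOn-++ (a ∷ as) bs f = trans (cong (f a +_) (sumOn-++ as bs f))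
                                 (sym (ℕ.+-assoc (f a) (sumOn as f) (sumOn bs f)))

  sumOn-map : ∀ {B : Set} (h : B → A) bs f → sumOn (List.map h bs) f ≡ sumOn bs (f ∘ h)
  sumOn-map h []       f = refl
  sumOn-map h (b ∷ bs) f = cong (f (h b) +_) (sumOn-map h bs f)

  sumOn-concatMap : ∀ {B : Set} (h : B → List A) bs f →
                    sumOn (List.concatMap h bs) f ≡ sumOn bs (λ b → sumOn (h b) f)
  sumOn-concatMap h []       f = refl
  sumOn-concatMap h (b ∷ bs) f = trans (sumOn-++ (h b) (List.concatMap h bs) f)
                                       (cong (sumOn (h b) f +_) (sumOn-concatMap h bs f))

  sumOn-cartesianProductWith : ∀ {B C : Set} (h : B → C → A) bs cs f →
    sumOn (List.cartesianProductWith h bs cs) f ≡ sumOn bs (λ b → sumOn cs (λ c → f (h b c)))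
  sumOn-cartesianProductWith h []       cs f = refl
  sumOn-cartesianProductWith h (b ∷ bs) cs f =
    trans (sumOn-++ (List.map (h b) cs) (List.cartesianProductWith h bs cs) f)
          (cong₂ _+_ (sumOn-map (h b) cs f) (sumOn-cartesianProductWith h bs cs f))

  sumOn-filter : ∀ {P : Pred A 0ℓ} (P? : Unary.Decidable P) as f →
                 sumOn (List.filter P? as) f ≡ sumOn as (λ a → if does (P? a) then f a else 0)
  sumOn-filter P? []       f = refl
  sumOn-filter P? (a ∷ as) f with does (P? a)
  ... | true  = cong (f a +_) (sumOn-filter P? as f)
  ... | false = sumOn-filter P? as f

  sumOn-∉ : ∀ {as : List A} {a f} → a ∉ as → (∀ b → b ≢ a → f b ≡ 0) → sumOn as f ≡ 0
  sumOn-∉ {[]}     a∉ p = refl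
  sumOn-∉ {b ∷ as} a∉ p = cong₂ _+_ (p b λ { refl → a∉ (here refl) }) (sumOn-∉ (a∉ ∘ there) p)

  sumOn-single : ∀ {as : List A} {a f} → Unique as → a ∈ as →
                 (∀ b → b ≢ a → f b ≡ 0) → sumOn as f ≡ f a
  sumOn-single {a ∷ as} {f = f} (a≢ ∷ u) (here refl) p =
    trans (cong (f a +_) (sumOn-∉ (λ i → All.lookup a≢ i refl) p)) (ℕ.+-identityʳ (f a))
  sumOn-single {b ∷ as} (b≢ ∷ u) (there i)   p =
    cong₂ _+_ (p b (All.lookup b≢ i)) (sumOn-single u i p)

-- A product is linear in each factor; this carries Pascal's recurrence from the factor of one
-- letter to the whole product.
∏-+ : ∀ {n} (i : Fin n) (f g h : Fin n → ℕ) → f i ≡ g i + h i →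
      (∀ j → i ≢ j → f j ≡ g j) → (∀ j → i ≢ j → f j ≡ h j) → ∏ f ≡ ∏ g + ∏ h
∏-+ zero f g h f₀ f≡g f≡h = begin
  f zero * ∏ (f ∘ suc)
    ≡⟨ cong (_* ∏ (f ∘ suc)) f₀ ⟩
  (g zero + h zero) * ∏ (f ∘ suc)
    ≡⟨ ℕ.*-distribʳ-+ (∏ (f ∘ suc)) (g zero) (h zero) ⟩
  g zero * ∏ (f ∘ suc) + h zero * ∏ (f ∘ suc)
    ≡⟨ cong₂ (λ a b → g zero * a + h zero * b)
             (∏-cong λ j → f≡g (suc j) λ ()) (∏-cong λ j → f≡h (suc j) λ ()) ⟩
  g zero * ∏ (g ∘ suc) + h zero * ∏ (h ∘ suc) ∎
∏-+ (suc i) f g h fᵢ f≡g f≡h = begin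
  f zero * ∏ (f ∘ suc)
    ≡⟨ cong (f zero *_) (∏-+ i (f ∘ suc) (g ∘ suc) (h ∘ suc) fᵢ
         (λ j i≢j → f≡g (suc j) (i≢j ∘ Fin.suc-injective))
         (λ j i≢j → f≡h (suc j) (i≢j ∘ Fin.suc-injective))) ⟩
  f zero * (∏ (g ∘ suc) + ∏ (h ∘ suc))
    ≡⟨ ℕ.*-distribˡ-+ (f zero) _ _ ⟩
  f zero * ∏ (g ∘ suc) + f zero * ∏ (h ∘ suc)
    ≡⟨ cong₂ (λ a b → a * ∏ (g ∘ suc) + b * ∏ (h ∘ suc)) (f≡g zero λ ()) (f≡h zero λ ()) ⟩
  g zero * ∏ (g ∘ suc) + h zero * ∏ (h ∘ suc) ∎

-- `multichoose N m` is the number of multisets of size `m` on `N` elements, binomial (N+m-1 choose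
-- m); the recursion asks whether the first element is used, and a used element stays available.
multichoose : ℕ → ℕ → ℕ
multichoose _       zero    = 1
multichoose zero    (suc m) = 0
multichoose (suc N) (suc m) = multichoose N (suc m) + multichoose (suc N) m

occurrences : ∀ {n} → Fin n → List Key → ℕ
occurrences k L = sumOn L λ v → if does (proj₂ v ℕ.≟ toℕ k) then 1 else 0

multichooses : ∀ {n} → (Fin n → ℕ) → Vec ℕ n → ℕ
multichooses N μ = ∏ λ k → multichoose (N k) (lookup μ k)

multichooses-zero : ∀ {n} N (μ : Vec ℕ n) → 0 ≡ Vec.sum μ → multichooses N μ ≡ 1
multichooses-zero N []         p = refl
multichooses-zero N (zero ∷ μ) p = trans (ℕ.+-identityʳ _) (multichooses-zero (N ∘ suc) μ p)

multichooses-none : ∀ {n l} (μ : Vec ℕ n) → suc l ≡ Vec.sum μ → multichooses (λ _ → 0) μ ≡ 0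
multichooses-none (suc m ∷ μ) p = refl
multichooses-none (zero ∷ μ)  p = trans (ℕ.+-identityʳ _) (multichooses-none μ p)

sum-updateAt-pred : ∀ {n m} (μ : Vec ℕ n) k → lookup μ k ≡ suc m →
                    Vec.sum μ ≡ suc (Vec.sum (updateAt μ k pred))
sum-updateAt-pred (suc m ∷ μ) zero    p = refl
sum-updateAt-pred (a ∷ μ)     (suc k) p = trans (cong (a +_) (sum-updateAt-pred μ k p)) (ℕ.+-suc a _)

multiplicity-same : ∀ {n l} {r : Vec ℕ n} (u : Letter r) (w : Vec (Letter r) l) →
                    multiplicity (value u) (u ∷ w) ≡ suc (multiplicity (value u) w)
multiplicity-same u w rewrite dec-true (value u Fin.≟ value u) refl = refl

multiplicity-other : ∀ {n l} {r : Vec ℕ n} (u : Letter r) (w : Vec (Letter r) l) {k} → value u ≢ k →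
                     multiplicity k (u ∷ w) ≡ multiplicity k w
multiplicity-other u w {k} p rewrite dec-false (value u Fin.≟ k) p = refl

key-injective : ∀ {n} {r : Vec ℕ n} {u v : Letter r} → key u ≡ key v → u ≡ v
key-injective {u = k ⟨ c ⟩} {k′ ⟨ c′ ⟩} p with refl ← Fin.toℕ-injective (cong proj₂ p) =
  cong (k ⟨_⟩) (Fin.toℕ-injective (cong proj₁ p))

module _ {n} (r : Vec ℕ n) where

  sumOn-letters : ∀ (u : Letter r) {f} → (∀ v → v ≢ u → f v ≡ 0) → sumOn (letters r) f ≡ f u
  sumOn-letters (k ⟨ c ⟩) {f} p = begin
    sumOn (letters r) f
      ≡⟨ sumOn-concatMap colored (List.allFin n) f ⟩
    sumOn (List.allFin n) (λ j → sumOn (colored j) f)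
      ≡⟨ sumOn-single (Unique.allFin⁺ n) (∈-allFin k) (λ j j≢k →
           trans (sumOn-map (j ⟨_⟩) (List.allFin (lookup r j)) f)
                 (sumOn-zero (List.allFin (lookup r j)) λ d → p (j ⟨ d ⟩) λ { refl → j≢k refl })) ⟩
    sumOn (colored k) f
      ≡⟨ sumOn-map (k ⟨_⟩) (List.allFin (lookup r k)) f ⟩
    sumOn (List.allFin (lookup r k)) (λ d → f (k ⟨ d ⟩))
      ≡⟨ sumOn-single (Unique.allFin⁺ (lookup r k)) (∈-allFin c)
           (λ d d≢c → p (k ⟨ d ⟩) λ { refl → d≢c refl }) ⟩
    f (k ⟨ c ⟩) ∎
    where
    colored : Fin n → List (Letter r)
    colored j = List.map (j ⟨_⟩) (List.allFin (lookup r j))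

  totalChains : ℕ → List Key → Vec ℕ n → ℕ
  totalChains l L μ =
    sumOn (words r l) λ w → if does (hasContent? μ w) then chains (Vec.map key w) L else 0

  -- The hypothesis keeps `pred` from truncating, so that it undoes the adding of one letter.
  hasContent-∷ : ∀ {l m} {μ : Vec ℕ n} (u : Letter r) {w : Vec (Letter r) l} →
                 lookup μ (value u) ≡ suc m →
                 HasContent μ (u ∷ w) ⇔ HasContent (updateAt μ (value u) pred) w
  hasContent-∷ {m = m} {μ} u {w} p = mk⇔ forth back
    where
    u∷w = u ∷ w
    μ′ = updateAt μ (value u) pred
    updated : lookup μ (value u) ≡ suc (lookup μ′ (value u))
    updated = trans p (cong suc (sym (trans (Vec.lookup∘updateAt (value u) μ) (cong pred p))))
    forth : HasContent μ u∷w → HasContent μ′ w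
    forth h k with value u Fin.≟ k
    ... | yes refl = ℕ.suc-injective (trans (sym (multiplicity-same u w)) (trans (h (value u)) updated))
    ... | no u≢k   = trans (sym (multiplicity-other u w u≢k))
                           (trans (h k) (sym (Vec.lookup∘updateAt′ k (value u) (u≢k ∘ sym) μ)))
    back : HasContent μ′ w → HasContent μ u∷w
    back h k = by (value u Fin.≟ k)
      where
      by : Dec (value u ≡ k) → multiplicity k u∷w ≡ lookup μ k
      by (yes refl) = trans (multiplicity-same u w) (trans (cong suc (h (value u))) (sym updated))
      by (no u≢k)   = trans (multiplicity-other u w u≢k)
                            (trans (h k) (Vec.lookup∘updateAt′ k (value u) (u≢k ∘ sym) μ))

  startingWith : ∀ l → List Key → Vec ℕ n → Letter r → ℕ
  startingWith l L μ u =
    sumOn (words r l) λ w → if does (hasContent? μ (u ∷ w)) then chains (Vec.map key w) L else 0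

  -- Either no letter is put on the first place, or the first letter of the word is, and then the
  -- word begins with `u`.
  totalChains-∷ : ∀ l u L μ →
    totalChains (suc l) (key u ∷ L) μ ≡ totalChains (suc l) L μ + startingWith l (key u ∷ L) μ u
  totalChains-∷ l u L μ = begin
    totalChains (suc l) (key u ∷ L) μ
      ≡⟨ sumOn-cong (words r (suc l)) (λ { (v ∷ w) →
           if-+ (does (hasContent? μ (v ∷ w))) (chains (key v ∷ Vec.map key w) L) _ }) ⟩
    sumOn (words r (suc l)) (λ w → old w + new w)
      ≡⟨ sumOn-+ (words r (suc l)) old new ⟩
    totalChains (suc l) L μ + sumOn (words r (suc l)) new
      ≡⟨ cong (totalChains (suc l) L μ +_)
              (sumOn-cartesianProductWith _∷_ (letters r) (words r l) new) ⟩
    totalChains (suc l) L μ + sumOn (letters r) (λ v → sumOn (words r l) λ w → new (v ∷ w))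
      ≡⟨ cong (totalChains (suc l) L μ +_)
              (sumOn-letters u λ v v≢u → sumOn-zero (words r l) (other v v≢u)) ⟩
    totalChains (suc l) L μ + sumOn (words r l) (λ w → new (u ∷ w))
      ≡⟨ cong (totalChains (suc l) L μ +_) (sumOn-cong (words r l) same) ⟩
    totalChains (suc l) L μ + startingWith l (key u ∷ L) μ u ∎
    where
    old new : Vec (Letter r) (suc l) → ℕ
    old w = if does (hasContent? μ w) then chains (Vec.map key w) L else 0
    new w@(v ∷ w′) = if does (hasContent? μ w)
      then (if does (key u ≟ₖ key v) then chains (Vec.map key w′) (key u ∷ L) else 0) else 0
    if-+ : ∀ b x y → (if b then x + y else 0) ≡ (if b then x else 0) + (if b then y else 0)
    if-+ true  x y = refl
    if-+ false x y = refl
    if-0 : ∀ b → (if b then 0 else 0) ≡ 0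
    if-0 true  = refl
    if-0 false = refl
    other : ∀ v → v ≢ u → ∀ w → new (v ∷ w) ≡ 0
    other v v≢u w rewrite dec-false (key u ≟ₖ key v) (v≢u ∘ sym ∘ key-injective) =
      if-0 (does (hasContent? μ (v ∷ w)))
    same : ∀ w → new (u ∷ w) ≡
           (if does (hasContent? μ (u ∷ w)) then chains (Vec.map key w) (key u ∷ L) else 0)
    same w rewrite dec-true (key u ≟ₖ key u) refl = refl

  startingWith-zero : ∀ l L μ u → lookup μ (value u) ≡ 0 → startingWith l L μ u ≡ 0
  startingWith-zero l L μ u p = sumOn-zero (words r l) λ w →
    cong (λ b → if b then chains (Vec.map key w) L else 0)
         (dec-false (hasContent? μ (u ∷ w))
           λ h → ℕ.1+n≢0 (trans (sym (multiplicity-same u w)) (trans (h (value u)) p)))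

  startingWith-suc : ∀ {m} l L μ u → lookup μ (value u) ≡ suc m →
                     startingWith l L μ u ≡ totalChains l L (updateAt μ (value u) pred)
  startingWith-suc l L μ u p = sumOn-cong (words r l) λ w →
    cong (λ b → if b then chains (Vec.map key w) L else 0)
         (does-⇔ (hasContent-∷ {μ = μ} u {w} p)
                 (hasContent? μ (u ∷ w)) (hasContent? (updateAt μ (value u) pred) w))

  occurrences-same : ∀ (u : Letter r) L →
                     occurrences (value u) (key u ∷ L) ≡ suc (occurrences (value u) L)
  occurrences-same u L rewrite dec-true (toℕ (value u) ℕ.≟ toℕ (value u)) refl = refl

  occurrences-other : ∀ (u : Letter r) {k} L → value u ≢ k →
                      occurrences k (key u ∷ L) ≡ occurrences k L
  occurrences-other u {k} L p
    rewrite dec-false (toℕ (value u) ℕ.≟ toℕ k) (p ∘ Fin.toℕ-injective) = refl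

  totalChains-product : ∀ l L μ → All (λ v → ∃ λ (u : Letter r) → v ≡ key u) L → l ≡ Vec.sum μ →
                        totalChains l L μ ≡ multichooses (λ k → occurrences k L) μ
  totalChains-product zero L μ ps eq = begin
    totalChains zero L μ
      ≡⟨ ℕ.+-identityʳ _ ⟩
    (if does (hasContent? {r = r} μ []) then 1 else 0)
      ≡⟨ cong (λ b → if b then 1 else 0) (dec-true (hasContent? {r = r} μ []) (empty μ eq)) ⟩
    1
      ≡⟨ multichooses-zero (λ k → occurrences k L) μ eq ⟨
    multichooses (λ k → occurrences k L) μ ∎
    where
    empty : ∀ {n} (μ : Vec ℕ n) → 0 ≡ Vec.sum μ → ∀ k → 0 ≡ lookup μ k
    empty (zero ∷ μ) eq zero    = refl
    empty (zero ∷ μ) eq (suc k) = empty μ eq k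
  totalChains-product (suc l) [] μ ps eq = trans
    (sumOn-zero (words r (suc l)) λ { w@(_ ∷ _) → none (does (hasContent? μ w)) })
    (sym (multichooses-none μ eq))
    where
    none : ∀ b → (if b then 0 else 0) ≡ 0
    none true  = refl
    none false = refl
  totalChains-product (suc l) (v ∷ L) μ ((u , refl) ∷ ps) eq = begin
    totalChains (suc l) (key u ∷ L) μ
      ≡⟨ totalChains-∷ l u L μ ⟩
    totalChains (suc l) L μ + startingWith l (key u ∷ L) μ u
      ≡⟨ cong (_+ startingWith l (key u ∷ L) μ u) (totalChains-product (suc l) L μ ps eq) ⟩
    multichooses (λ k → occurrences k L) μ + startingWith l (key u ∷ L) μ u
      ≡⟨ by (lookup μ (value u)) refl ⟩
    multichooses (λ k → occurrences k (key u ∷ L)) μ ∎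
    where
    N N′ : Fin n → ℕ
    N  k = occurrences k L
    N′ k = occurrences k (key u ∷ L)
    by : ∀ m → lookup μ (value u) ≡ m →
         multichooses N μ + startingWith l (key u ∷ L) μ u ≡ multichooses N′ μ
    by zero p = begin
      multichooses N μ + startingWith l (key u ∷ L) μ u
        ≡⟨ cong (multichooses N μ +_) (startingWith-zero l (key u ∷ L) μ u p) ⟩
      multichooses N μ + 0
        ≡⟨ ℕ.+-identityʳ _ ⟩
      multichooses N μ
        ≡⟨ ∏-cong (λ k → factor k (value u Fin.≟ k)) ⟩
      multichooses N′ μ ∎
      where
      factor : ∀ k → Dec (value u ≡ k) →
               multichoose (N k) (lookup μ k) ≡ multichoose (N′ k) (lookup μ k)
      factor k (yes refl) rewrite p = refl
      factor k (no u≢k)   = cong (λ a → multichoose a (lookup μ k)) (sym (occurrences-other u L u≢k))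
    by (suc m) p = begin
      multichooses N μ + startingWith l (key u ∷ L) μ u
        ≡⟨ cong (multichooses N μ +_) (startingWith-suc l (key u ∷ L) μ u p) ⟩
      multichooses N μ + totalChains l (key u ∷ L) μ′
        ≡⟨ cong (multichooses N μ +_)
                -- The list keeps its first place here; it is the word that gets shorter.
                (totalChains-product l (key u ∷ L) μ′ ((u , refl) ∷ ps)
                  (ℕ.suc-injective (trans eq (sum-updateAt-pred μ (value u) p)))) ⟩
      multichooses N μ + multichooses N′ μ′
        ≡⟨ ∏-+ (value u) _ _ _ pascal
             (λ k u≢k → cong (λ a → multichoose a (lookup μ k)) (occurrences-other u L u≢k))
             (λ k u≢k → cong (multichoose (N′ k))
                          (sym (Vec.lookup∘updateAt′ k (value u) (u≢k ∘ sym) μ))) ⟨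
      multichooses N′ μ ∎
      where
      μ′ = updateAt μ (value u) pred
      pascal : multichoose (N′ (value u)) (lookup μ (value u)) ≡
               multichoose (N (value u)) (lookup μ (value u)) +
               multichoose (N′ (value u)) (lookup μ′ (value u))
      pascal rewrite occurrences-same u L | Vec.lookup∘updateAt (value u) {f = pred} μ | p = refl

-- The series of the colored Eulerian polynomial

module _ (r n : ℕ) .{{_ : NonZero r}} where

  occurrences-rows : ∀ (k : Fin n) cs → occurrences k (cartesianProduct cs (upTo n)) ≡ List.length cs
  occurrences-rows k cs = begin
    occurrences k (cartesianProduct cs (upTo n))
      ≡⟨ sumOn-cartesianProductWith _,_ cs (upTo n) (indicator ∘ proj₂) ⟩
    sumOn cs (λ _ → sumOn (upTo n) indicator)
      ≡⟨ sumOn-cong cs (λ _ → trans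
           (sumOn-single (Unique.upTo⁺ n) (∈-upTo⁺ (Fin.toℕ<n k))
             (λ j j≢k → cong (λ b → if b then 1 else 0) (dec-false (j ℕ.≟ toℕ k) j≢k)))
           (cong (λ b → if b then 1 else 0) (dec-true (toℕ k ℕ.≟ toℕ k) refl))) ⟩
    sumOn cs (λ _ → 1)
      ≡⟨ count-ones cs ⟩
    List.length cs ∎
    where
    indicator : ℕ → ℕ
    indicator j = if does (j ℕ.≟ toℕ k) then 1 else 0
    count-ones : ∀ (cs : List ℕ) → sumOn cs (λ _ → 1) ≡ List.length cs
    count-ones []       = refl
    count-ones (_ ∷ cs) = cong suc (count-ones cs)

  -- Each full block has the letter in all `r` colors, and the last level only in the first color.
  occurrences-levels : ∀ (k : Fin n) t → occurrences k (levels r n t) ≡ t * r + 1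
  occurrences-levels k zero    = occurrences-rows k (upTo 1)
  occurrences-levels k (suc t) = begin
    occurrences k (block r n ++ levels r n t)
      ≡⟨ sumOn-++ (block r n) (levels r n t) _ ⟩
    occurrences k (block r n) + occurrences k (levels r n t)
      ≡⟨ cong₂ _+_ (trans (occurrences-rows k (upTo r)) (length-upTo r)) (occurrences-levels k t) ⟩
    r + (t * r + 1)
      ≡⟨ ℕ.+-assoc r (t * r) 1 ⟨
    suc t * r + 1 ∎

  levels-bounded : ∀ t → All (λ v → proj₁ v ℕ.< r × proj₂ v ℕ.< n) (levels r n t)
  levels-bounded zero    = All.tabulate λ {v} i →
    subst (ℕ._< r) (sym (∈-level₀⁻ r n i)) (ℕ.>-nonZero⁻¹ r) ,
    ∈-upTo⁻ (proj₂ (∈-cartesianProduct⁻ (upTo 1) (upTo n) i))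
  levels-bounded (suc t) = All.++⁺ (All.tabulate λ i →
    let p , q = ∈-cartesianProduct⁻ (upTo r) (upTo n) i in ∈-upTo⁻ p , ∈-upTo⁻ q) (levels-bounded t)

  private
    r̲ : Vec ℕ n
    r̲ = Vec.replicate n r

  bounded-key : ∀ {v} → proj₁ v ℕ.< r × proj₂ v ℕ.< n → ∃ λ (u : Letter r̲) → v ≡ key u
  bounded-key {c , k} (c<r , k<n) =
    i ⟨ Fin.fromℕ< c<rᵢ ⟩ , cong₂ _,_ (sym (Fin.toℕ-fromℕ< c<rᵢ)) (sym (Fin.toℕ-fromℕ< k<n))
    where
    i : Fin n
    i = Fin.fromℕ< k<n
    c<rᵢ : c ℕ.< lookup r̲ i
    c<rᵢ = subst (c ℕ.<_) (sym (Vec.lookup-replicate i r)) c<r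

  key-bounded : ∀ (u : Letter r̲) → proj₁ (key u) ℕ.< r × proj₂ (key u) ℕ.< n
  key-bounded (k ⟨ c ⟩) = subst (toℕ c ℕ.<_) (Vec.lookup-replicate k r) (Fin.toℕ<n c) , Fin.toℕ<n k

  module _ (m : Vec ℕ n) where

    permutationChains : ∀ t →
      sumOn (coloredPermutations m r̲) (λ w → chains (Vec.map key w) (levels r n t)) ≡
      multichooses (λ _ → t * r + 1) m
    permutationChains t = begin
      sumOn (coloredPermutations m r̲) (λ w → chains (Vec.map key w) (levels r n t))
        ≡⟨ sumOn-filter (hasContent? m) (words r̲ (Vec.sum m)) _ ⟩
      totalChains r̲ (Vec.sum m) (levels r n t) m
        ≡⟨ totalChains-product r̲ (Vec.sum m) (levels r n t) m
             (All.map bounded-key (levels-bounded t)) refl ⟩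
      multichooses (λ k → occurrences k (levels r n t)) m
        ≡⟨ ∏-cong (λ k → cong (λ N → multichoose N (lookup m k)) (occurrences-levels k t)) ⟩
      multichooses (λ _ → t * r + 1) m ∎

    -- The product counts all spread words at once. Multiplication by the power of 1-x takes
    -- `suc (Vec.sum m)` differences, and these, taken word by word, leave x^des for each word.
    coloredEulerian-series :
      (λ t → ℤ.+ multichooses (λ _ → t * r + 1) m) ⊛ 1-x ^ₛ suc (Vec.sum m) ≗ coloredEulerian m r̲
    coloredEulerian-series j = begin
      ((λ t → ℤ.+ multichooses (λ _ → t * r + 1) m) ⊛ 1-x ^ₛ suc l) j
        ≡⟨ ⊛-1-x^ (suc l) _ j ⟩
      Δ^ (suc l) (λ t → ℤ.+ multichooses (λ _ → t * r + 1) m) j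
        ≡⟨ Δ^-cong (suc l) (λ t → trans (cong ℤ.+_ (sym (permutationChains t)))
                                        (pos-sumOn (coloredPermutations m r̲) t)) j ⟩
      Δ^ (suc l) (Σₛ (coloredPermutations m r̲) (λ w → levelCount r n (Vec.map key w))) j
        ≡⟨ Δ^-Σₛ (suc l) (coloredPermutations m r̲)
             (λ w → Δ^-levelCount r n (VecAll.map⁺ (VecAll.universal key-bounded w))) j ⟩
      coloredEulerian m r̲ j ∎
      where
      l = Vec.sum m
      pos-sumOn : ∀ (ws : List (Vec (Letter r̲) l)) t →
                  ℤ.+ sumOn ws (λ w → chains (Vec.map key w) (levels r n t)) ≡
                  Σₛ ws (λ w → levelCount r n (Vec.map key w)) t
      pos-sumOn []       t = refl
      pos-sumOn (w ∷ ws) t = trans (ℤ.pos-+ (chains (Vec.map key w) (levels r n t)) _)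
                                   (cong (ℤ._+_ (levelCount r n (Vec.map key w) t)) (pos-sumOn ws t))

-- Counting lattice points coordinate by coordinate

module _ {A : Set} where

  hasCardinality-⇔ : ∀ {P Q : Pred A 0ℓ} {c} → (∀ a → P a ⇔ Q a) →
                     HasCardinality P c → HasCardinality Q c
  hasCardinality-⇔ P⇔Q (as , u , mem , len) =
    as , u , (λ a → mk⇔ (to (P⇔Q a) ∘ to (mem a)) (from (mem a) ∘ from (P⇔Q a))) , len

  hasCardinality-∪ : ∀ {P Q : Pred A 0ℓ} {c d} → (∀ {a} → P a → ¬ Q a) →
                     HasCardinality P c → HasCardinality Q d →
                     HasCardinality (λ a → P a ⊎ Q a) (c + d)
  hasCardinality-∪ disjoint (as , u , mem , len) (bs , v , mem′ , len′) =
    as ++ bs ,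
    Unique.++⁺ u v (λ { (i , j) → disjoint (to (mem _) i) (to (mem′ _) j) }) ,
    (λ a → mk⇔ (Sum.map (to (mem a)) (to (mem′ a)) ∘ ∈-++⁻ as)
               Sum.[ ∈-++⁺ˡ ∘ from (mem a) , ∈-++⁺ʳ as ∘ from (mem′ a) ]) ,
    trans (length-++ as) (cong₂ _+_ len len′)

  hasCardinality-image : ∀ {B : Set} {P : Pred A 0ℓ} {c} (f : A → B) →
                         (∀ {a b} → f a ≡ f b → a ≡ b) →
                         HasCardinality P c → HasCardinality (λ b → ∃[ a ] P a × b ≡ f a) c
  hasCardinality-image f inj (as , u , mem , len) =
    List.map f as ,
    Unique.map⁺ inj u ,
    (λ b → mk⇔ (λ i → let a , a∈ , eq = ∈-map⁻ f i in a , to (mem a) a∈ , eq)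
               (λ { (a , pa , refl) → ∈-map⁺ f (from (mem a) pa) })) ,
    trans (length-map f as) len

module _ {A : Set} {R : Rel A 0ℓ} where

  linked-∷ʳ : ∀ {n x y z} (xs : Vec A n) →
              Linked R (x ∷ (xs ∷ʳ y ∷ʳ z)) ⇔ (Linked R (x ∷ (xs ∷ʳ y)) × R y z)
  linked-∷ʳ []       = mk⇔ (λ { (p ∷ q ∷ [-]) → p ∷ [-] , q }) (λ { (p ∷ [-] , q) → p ∷ q ∷ [-] })
  linked-∷ʳ (_ ∷ xs) = mk⇔ (λ { (p ∷ ps) → let qs , q = to (linked-∷ʳ xs) ps in p ∷ qs , q })
                           (λ { (p ∷ ps , q) → p ∷ from (linked-∷ʳ xs) (ps , q) })

-- Cross-multiplication of fractions

/-≤ : ∀ a b m n .{{_ : NonZero m}} .{{_ : NonZero n}} →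
      (a ℚ./ m) ℚ.≤ (b ℚ./ n) ⇔ a ℤ.* ℤ.+ n ℤ.≤ b ℤ.* ℤ.+ m
/-≤ a b (suc m) (suc n) = mk⇔
  (λ p → ℚᵘ.drop-*≤* (ℚᵘ.≤-respˡ-≃ (ℚ.toℚᵘ-fromℚᵘ (mkℚᵘ a m))
                       (ℚᵘ.≤-respʳ-≃ (ℚ.toℚᵘ-fromℚᵘ (mkℚᵘ b n)) (ℚ.toℚᵘ-mono-≤ p))))
  (λ p → ℚ.toℚᵘ-cancel-≤ (ℚᵘ.≤-respˡ-≃ (ℚᵘ.≃-sym (ℚ.toℚᵘ-fromℚᵘ (mkℚᵘ a m)))
                            (ℚᵘ.≤-respʳ-≃ (ℚᵘ.≃-sym (ℚ.toℚᵘ-fromℚᵘ (mkℚᵘ b n))) (ℚᵘ.*≤* p))))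

/-≡ : ∀ a b m n .{{_ : NonZero m}} .{{_ : NonZero n}} →
      a ℚ./ m ≡ b ℚ./ n ⇔ a ℤ.* ℤ.+ n ≡ b ℤ.* ℤ.+ m
/-≡ a b (suc m) (suc n) = mk⇔
  (λ p → ℚᵘ.drop-*≡* (ℚᵘ.≃-trans (ℚᵘ.≃-sym (ℚ.toℚᵘ-fromℚᵘ (mkℚᵘ a m)))
                       (ℚᵘ.≃-trans (ℚᵘ.≃-reflexive (cong ℚ.toℚᵘ p)) (ℚ.toℚᵘ-fromℚᵘ (mkℚᵘ b n)))))
  (λ p → ℚ.fromℚᵘ-cong {mkℚᵘ a m} {mkℚᵘ b n} (ℚᵘ.*≡* p))

/-* : ∀ a b m n .{{_ : NonZero m}} .{{_ : NonZero n}} →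
      (a ℚ./ m) ℚ.* (b ℚ./ n) ≡ ℚ._/_ (a ℤ.* b) (m * n) {{ℕ.m*n≢0 m n}}
/-* a b (suc m) (suc n) = ℚ.toℚᵘ-injective (ℚᵘ.≃-trans (ℚ.toℚᵘ-homo-* (a ℚ./ suc m) (b ℚ./ suc n))
  (ℚᵘ.≃-trans (ℚᵘ.*-cong (ℚ.toℚᵘ-fromℚᵘ (mkℚᵘ a m)) (ℚ.toℚᵘ-fromℚᵘ (mkℚᵘ b n)))
              (ℚᵘ.≃-sym (ℚ.toℚᵘ-fromℚᵘ (mkℚᵘ a m ℚᵘ.* mkℚᵘ b n)))))

-- Lattice points under lecture hall inequalities

ratios : (s : ℕ → ℕ) .{{_ : ∀ {i} → NonZero (s i)}} → ∀ {N} → Vec ℤ N → Vec ℚ N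
ratios s z = tabulate λ i → lookup z i ℚ./ s (toℕ i)

ratios-∷ʳ : ∀ (s : ℕ → ℕ) .{{_ : ∀ {i} → NonZero (s i)}} {N} (z : Vec ℤ N) y →
            ratios s (z ∷ʳ y) ≡ ratios s z ∷ʳ (y ℚ./ s N)
ratios-∷ʳ s []      y = refl
ratios-∷ʳ s (a ∷ z) y = cong (a ℚ./ s 0 ∷_) (ratios-∷ʳ (s ∘ suc) z y)

module _ (s : ℕ → ℕ) .{{_ : ∀ {i} → NonZero (s i)}} where

  -- The bound `b` is an arbitrary rational so that fixing the last coordinate leaves a condition of
  -- the same form one dimension lower.
  Hall : ∀ {N} → ℚ → Pred (Vec ℤ N) 0ℓ
  Hall b z = Linked ℚ._≤_ (0ℚ ∷ (ratios s z ∷ʳ b))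

  hall-∷ʳ : ∀ {N b} (z : Vec ℤ N) y → Hall b (z ∷ʳ y) ⇔ (Hall (y ℚ./ s N) z × y ℚ./ s N ℚ.≤ b)
  hall-∷ʳ {N} {b} z y = subst
    (λ v → Linked ℚ._≤_ (0ℚ ∷ (v ∷ʳ b)) ⇔ (Hall (y ℚ./ s N) z × y ℚ./ s N ℚ.≤ b))
    (sym (ratios-∷ʳ s z y)) (linked-∷ʳ (ratios s z))

  hall-nonNegative : ∀ {N b} (z : Vec ℤ N) → Hall b z → 0ℚ ℚ.≤ b
  hall-nonNegative []      (p ∷ _)       = p
  hall-nonNegative {b = b} (_ ∷ z) (p ∷ q) = go (tabulate _) p q
    where
    go : ∀ {n a} (xs : Vec ℚ n) → 0ℚ ℚ.≤ a → Linked ℚ._≤_ (a ∷ (xs ∷ʳ b)) → 0ℚ ℚ.≤ b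
    go []       p (q ∷ _) = ℚ.≤-trans p q
    go (_ ∷ xs) p (q ∷ r) = go xs (ℚ.≤-trans p q) r

  -- With the rational bound replaced by an integer bound on the last coordinate, the count can grow
  -- in unit steps.
  Below : ∀ {N} → ℕ → Pred (Vec ℤ (suc N)) 0ℓ
  Below {N} j w = ∃₂ λ z y → w ≡ z ∷ʳ y × y ℤ.≤ ℤ.+ j × Hall (y ℚ./ s N) z

  -- The two inequalities make `j` the integral part of `u * s N / v`, and an integer last
  -- coordinate is at most that quotient exactly if it is at most `j`.
  hall⇔below : ∀ {N} u v {j} .{{_ : NonZero v}} → j * v ≤ u * s N → u * s N < suc j * v →
               ∀ (w : Vec ℤ (suc N)) → Hall (ℤ.+ u ℚ./ v) w ⇔ Below j w
  hall⇔below {N} u v {j} lower upper w = mk⇔ below hall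
    where
    bound : ∀ y → y ℤ.* ℤ.+ v ℤ.≤ ℤ.+ u ℤ.* ℤ.+ s N → y ℤ.≤ ℤ.+ j
    bound (ℤ.+ y)    p = ℤ.+≤+ (s≤s⁻¹ (ℕ.*-cancelʳ-< v y (suc j)
      (ℕ.≤-<-trans (ℤ.drop‿+≤+ (subst₂ ℤ._≤_ (sym (ℤ.pos-* y v)) (sym (ℤ.pos-* u (s N))) p)) upper)))
    bound ℤ.-[1+ y ] p = ℤ.-≤+
    below : Hall (ℤ.+ u ℚ./ v) w → Below j w
    below h with z , y , refl ← initLast w =
      let h′ , y/s≤u/v = to (hall-∷ʳ z y) h in
      z , y , refl , bound y (to (/-≤ y (ℤ.+ u) (s N) v) y/s≤u/v) , h′
    hall : Below j w → Hall (ℤ.+ u ℚ./ v) w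
    hall (z , y , refl , y≤j , h) = from (hall-∷ʳ z y) (h , from (/-≤ y (ℤ.+ u) (s N) v)
      (ℤ.≤-trans (ℤ.*-monoʳ-≤-nonNeg (ℤ.+ v) y≤j)
        (subst₂ ℤ._≤_ (ℤ.pos-* j v) (ℤ.pos-* u (s N)) (ℤ.+≤+ lower))))

  hall-last-nonNegative : ∀ {N} (z : Vec ℤ N) y → Hall (y ℚ./ s N) z → 0ℤ ℤ.≤ y
  hall-last-nonNegative {N} z y h =
    subst (0ℤ ℤ.≤_) (ℤ.*-identityʳ y) (to (/-≤ 0ℤ y 1 (s N)) (hall-nonNegative z h))

  below-zero : ∀ {N c} → HasCardinality (Hall {N} (0ℤ ℚ./ s N)) c → HasCardinality (Below {N} 0) c
  below-zero {N} =
    hasCardinality-⇔ equiv ∘ hasCardinality-image (_∷ʳ 0ℤ) (λ {a} {b} → Vec.∷ʳ-injectiveˡ a b)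
    where
    equiv : ∀ w → (∃[ z ] Hall {N} (0ℤ ℚ./ s N) z × w ≡ z ∷ʳ 0ℤ) ⇔ Below 0 w
    equiv w = mk⇔
      (λ { (z , h , eq) → z , 0ℤ , eq , ℤ.≤-refl , h })
      (λ { (z , y , eq , y≤0 , h) →
             let y≡0 = ℤ.≤-antisym y≤0 (hall-last-nonNegative z y h) in
             z , subst (λ y → Hall (y ℚ./ s N) z) y≡0 h , trans eq (cong (z ∷ʳ_) y≡0) })

  -- The new points have last coordinate exactly `suc j`, and dropping it leaves a chain bounded by
  -- `suc j / s N`.
  below-suc : ∀ {N j c d} → HasCardinality (Below {N} j) c →
              HasCardinality (Hall {N} (ℤ.+ suc j ℚ./ s N)) d →
              HasCardinality (Below {N} (suc j)) (c + d)
  below-suc {N} {j} below hall = hasCardinality-⇔ equiv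
    (hasCardinality-∪ disjoint below
      (hasCardinality-image (_∷ʳ (ℤ.+ suc j)) (λ {a} {b} → Vec.∷ʳ-injectiveˡ a b) hall))
    where
    Top : Pred (Vec ℤ (suc N)) 0ℓ
    Top w = ∃[ z ] Hall {N} (ℤ.+ suc j ℚ./ s N) z × w ≡ z ∷ʳ (ℤ.+ suc j)
    disjoint : ∀ {w} → Below j w → ¬ Top w
    disjoint (z , y , eq , y≤j , _) (z′ , _ , eq′) =
      ℤ.<⇒≱ (ℤ.+<+ (ℕ.n<1+n j)) (subst (ℤ._≤ ℤ.+ j) (Vec.∷ʳ-injectiveʳ z z′ (trans (sym eq) eq′)) y≤j)
    split : ∀ {y} → y ℤ.≤ ℤ.+ suc j → y ℤ.≤ ℤ.+ j ⊎ y ≡ ℤ.+ suc j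
    split ℤ.-≤+       = inj₁ ℤ.-≤+
    split (ℤ.+≤+ y≤) = Sum.map (ℤ.+≤+ ∘ s≤s⁻¹) (cong λ y → ℤ.+ y) (ℕ.m≤n⇒m<n∨m≡n y≤)
    equiv : ∀ w → (Below j w ⊎ Top w) ⇔ Below (suc j) w
    equiv w = mk⇔
      Sum.[ (λ { (z , y , eq , y≤j , h) → z , y , eq , ℤ.≤-trans y≤j (ℤ.+≤+ (ℕ.n≤1+n j)) , h })
          , (λ { (z , h , eq) → z , ℤ.+ suc j , eq , ℤ.≤-refl , h }) ]
      (λ { (z , y , eq , y≤ , h) →
             Sum.map (λ y≤j → z , y , eq , y≤j , h) (λ { refl → z , h , eq }) (split y≤) })

  -- Dilating the simplex of a multiple of the sequence

  module _ (t r : ℕ) .{{_ : NonZero t}} .{{_ : NonZero r}} where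

    private
      T : ℚ
      T = ℤ.+ (t * r) ℚ./ 1

      instance
        rs≢0 : ∀ {i} → NonZero (r * s i)
        rs≢0 {i} = ℕ.m*n≢0 r (s i)

        T⁺ : ℚ.Positive T
        T⁺ = ℚ.normalize-pos (t * r) 1 {{_}} {{ℕ.m*n≢0 t r}}

      scaled-fraction : ∀ z a m i .{{_ : NonZero m}} → z ℚ./ 1 ≡ (ℤ.+ t ℚ./ 1) ℚ.* (a ℚ./ m) →
                        T ℚ.* ((a ℚ./ m) ℚ.* (1ℤ ℚ./ (r * s i))) ≡ z ℚ./ s i
      scaled-fraction z a m i p = begin
        T ℚ.* ((a ℚ./ m) ℚ.* (1ℤ ℚ./ (r * s i)))
          ≡⟨ cong (T ℚ.*_) (/-* a 1ℤ m (r * s i)) ⟩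
        T ℚ.* ((a ℤ.* 1ℤ) ℚ./ (m * (r * s i)))
          ≡⟨ /-* (ℤ.+ (t * r)) (a ℤ.* 1ℤ) 1 (m * (r * s i)) ⟩
        (ℤ.+ (t * r) ℤ.* (a ℤ.* 1ℤ)) ℚ./ (1 * (m * (r * s i)))
          ≡⟨ from (/-≡ (ℤ.+ (t * r) ℤ.* (a ℤ.* 1ℤ)) z (1 * (m * (r * s i))) (s i)) cross ⟩
        z ℚ./ s i ∎
        where
        instance
          _ : NonZero (m * (r * s i))
          _ = ℕ.m*n≢0 m (r * s i)
          _ : NonZero (1 * (m * (r * s i)))
          _ = ℕ.m*n≢0 1 (m * (r * s i))
          _ : NonZero (1 * m)
          _ = ℕ.m*n≢0 1 m
        clear : z ℤ.* ℤ.+ (1 * m) ≡ (ℤ.+ t ℤ.* a) ℤ.* 1ℤ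
        clear = to (/-≡ z (ℤ.+ t ℤ.* a) 1 (1 * m)) (trans p (/-* (ℤ.+ t) a 1 m))
        cross : (ℤ.+ (t * r) ℤ.* (a ℤ.* 1ℤ)) ℤ.* ℤ.+ s i ≡ z ℤ.* ℤ.+ (1 * (m * (r * s i)))
        cross = begin
          (ℤ.+ (t * r) ℤ.* (a ℤ.* 1ℤ)) ℤ.* ℤ.+ s i
            ≡⟨ cong (λ y → (y ℤ.* (a ℤ.* 1ℤ)) ℤ.* ℤ.+ s i) (ℤ.pos-* t r) ⟩
          ((ℤ.+ t ℤ.* ℤ.+ r) ℤ.* (a ℤ.* 1ℤ)) ℤ.* ℤ.+ s i
            ≡⟨ lemma₁ (ℤ.+ t) (ℤ.+ r) a (ℤ.+ s i) ⟩
          ((ℤ.+ t ℤ.* a) ℤ.* 1ℤ) ℤ.* (ℤ.+ r ℤ.* ℤ.+ s i)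
            ≡⟨ cong (ℤ._* (ℤ.+ r ℤ.* ℤ.+ s i)) clear ⟨
          (z ℤ.* ℤ.+ (1 * m)) ℤ.* (ℤ.+ r ℤ.* ℤ.+ s i)
            ≡⟨ cong₂ (λ y y′ → (z ℤ.* y) ℤ.* y′) (cong ℤ.+_ (ℕ.*-identityˡ m)) (sym (ℤ.pos-* r (s i))) ⟩
          (z ℤ.* ℤ.+ m) ℤ.* ℤ.+ (r * s i)
            ≡⟨ ℤ.*-assoc z (ℤ.+ m) (ℤ.+ (r * s i)) ⟩
          z ℤ.* (ℤ.+ m ℤ.* ℤ.+ (r * s i))
            ≡⟨ cong (z ℤ.*_) (ℤ.pos-* m (r * s i)) ⟨
          z ℤ.* ℤ.+ (m * (r * s i))
            ≡⟨ cong (λ y → z ℤ.* ℤ.+ y) (ℕ.*-identityˡ (m * (r * s i))) ⟨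
          z ℤ.* ℤ.+ (1 * (m * (r * s i))) ∎
          where
          lemma₁ : ∀ t r a s → ((t ℤ.* r) ℤ.* (a ℤ.* 1ℤ)) ℤ.* s ≡ ((t ℤ.* a) ℤ.* 1ℤ) ℤ.* (r ℤ.* s)
          lemma₁ = ℤ-solve-∀

      scaled-ratio : ∀ z x i → z ℚ./ 1 ≡ (ℤ.+ t ℚ./ 1) ℚ.* x →
                     T ℚ.* (x ℚ.* (1ℤ ℚ./ (r * s i))) ≡ z ℚ./ s i
      scaled-ratio z x i p = subst (λ y → T ℚ.* (y ℚ.* (1ℤ ℚ./ (r * s i))) ≡ z ℚ./ s i) (ℚ.↥p/↧p≡p x)
        (scaled-fraction z (ℚ.↥ x) (ℚ.↧ₙ x) i (trans p (cong ((ℤ.+ t ℚ./ 1) ℚ.*_) (sym (ℚ.↥p/↧p≡p x)))))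

      scaled-chain : ∀ {N} {z : Vec ℤ N} {x} → Vec.map (ℚ._/ 1) z ≡ Vec.map ((ℤ.+ t ℚ./ 1) ℚ.*_) x →
                     Vec.map (T ℚ.*_) (0ℚ ∷ (scaled (λ i → r * s i) x ∷ʳ 1ℚ)) ≡ 0ℚ ∷ (ratios s z ∷ʳ T)
      scaled-chain {z = z} {x} p = cong₂ _∷_ (ℚ.*-zeroʳ T) (begin
        Vec.map (T ℚ.*_) (scaled (λ i → r * s i) x ∷ʳ 1ℚ)
          ≡⟨ Vec.map-∷ʳ (T ℚ.*_) 1ℚ (scaled (λ i → r * s i) x) ⟩
        Vec.map (T ℚ.*_) (scaled (λ i → r * s i) x) ∷ʳ (T ℚ.* 1ℚ)
          ≡⟨ cong₂ _∷ʳ_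
               (trans (sym (Vec.tabulate-∘ (T ℚ.*_) _))
                      (Vec.tabulate-cong λ i →
                         scaled-ratio (lookup z i) (lookup x i) (toℕ i) (entry i)))
               (ℚ.*-identityʳ T) ⟩
        ratios s z ∷ʳ T ∎)
        where
        entry : ∀ i → lookup z i ℚ./ 1 ≡ (ℤ.+ t ℚ./ 1) ℚ.* lookup x i
        entry i = trans (sym (Vec.lookup-map i (ℚ._/ 1) z))
                        (trans (cong (λ v → lookup v i) p) (Vec.lookup-map i ((ℤ.+ t ℚ./ 1) ℚ.*_) x))

      dilation : ∀ z → (ℤ.+ t ℚ./ 1) ℚ.* (z ℚ./ t) ≡ z ℚ./ 1
      dilation z = trans (/-* (ℤ.+ t) z 1 t)
        (from (/-≡ (ℤ.+ t ℤ.* z) z (1 * t) 1 {{ℕ.m*n≢0 1 t}})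
          (trans (lemma (ℤ.+ t) z) (cong (λ y → z ℤ.* ℤ.+ y) (sym (ℕ.*-identityˡ t)))))
        where
        lemma : ∀ t z → (t ℤ.* z) ℤ.* 1ℤ ≡ z ℤ.* t
        lemma = ℤ-solve-∀

    -- Multiplying the chain of x = z / t by `t * r` turns x_i / (r s_i) into z_i / s_i and the
    -- bound 1 into `t * r`; the factor `r` of the sequence becomes a further dilation.
    latticePoint⇔hall : ∀ {N} (z : Vec ℤ N) →
                        LatticePoint t (lectureHallSimplex (λ i → r * s i) N) z ⇔ Hall T z
    latticePoint⇔hall z = mk⇔
      (λ { (x , px , eq) → subst (Linked ℚ._≤_) (scaled-chain eq)
                             (Linked.map⁺ (Linked.map (ℚ.*-monoˡ-≤-nonNeg T {{ℚ.pos⇒nonNeg T}}) px)) })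
      (λ h → x , Linked.map (ℚ.*-cancelˡ-≤-pos T)
                   (Linked.map⁻ {f = T ℚ.*_} (subst (Linked ℚ._≤_) (sym (scaled-chain z≡tx)) h)) , z≡tx)
      where
      x : Vec ℚ _
      x = Vec.map (ℚ._/ t) z
      z≡tx : Vec.map (ℚ._/ 1) z ≡ Vec.map ((ℤ.+ t ℚ./ 1) ℚ.*_) x
      z≡tx = trans (Vec.map-cong (sym ∘ dilation) z) (Vec.map-∘ ((ℤ.+ t ℚ./ 1) ℚ.*_) (ℚ._/ t) z)

-- For q and p ≤ size, count q p is the number of lattice points satisfying the
-- chain of inequalities up to a last coordinate of at most size * q + p.

record Stage : Set where
  constructor stage
  field
    size  : ℕ
    count : ℕ → ℕ → ℕ

open Stage

-- prev p is the integral part of (p + 1) * size S / size S′.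

record Step (S S′ : Stage) : Set where
  field
    nonZero   : NonZero (size S′)
    start     : count S′ 0 0 ≡ count S 0 0
    wrap      : ∀ q → count S′ (suc q) 0 ≡ count S′ q (size S′)
    prev      : ℕ → ℕ
    prev-≤    : ∀ {p} → p < size S′ → prev p ≤ size S
    prev-low  : ∀ {p} → p < size S′ → prev p * size S′ ≤ suc p * size S
    prev-high : ∀ {p} → p < size S′ → suc p * size S < suc (prev p) * size S′
    next      : ∀ {p} q → p < size S′ → count S′ q (suc p) ≡ count S′ q p + count S q (prev p)

-- Induction on the dimension and the bound on the last coordinate

module _ (stages : ℕ → Stage) (size₀ : size (stages 0) ≡ 0)
         (count₀ : ∀ q → count (stages 0) q 0 ≡ 1)
         (steps : ∀ N → Step (stages N) (stages (suc N))) where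

  -- Stage N concerns N coordinates, so the coordinate with index N, counted from 0, first appears
  -- in stage `suc N`; stage 0 is the base of the induction and contributes no term.
  sizes : ℕ → ℕ
  sizes N = size (stages (suc N))

  instance
    sizes≢0 : ∀ {N} → NonZero (sizes N)
    sizes≢0 {N} = Step.nonZero (steps N)

  private
    σ : ℕ → ℕ
    σ N = size (stages N)

    F : ℕ → ℕ → ℕ → ℕ
    F N = count (stages N)

  mutual

    -- By the hypotheses `σ N * q + p` is the integral part of `u * σ N / v`. The value p = `σ N` is
    -- allowed since `prev` can reach it.
    hall-cardinality : ∀ N u v {q p} .{{_ : NonZero v}} → p ≤ σ N →
                       (σ N * q + p) * v ≤ u * σ N → u * σ N < suc (σ N * q + p) * v →
                       HasCardinality (Hall sizes {N} (ℤ.+ u ℚ./ v)) (F N q p)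
    hall-cardinality zero u v {q} {p} p≤ _ _ with refl ← ℕ.n≤0⇒n≡0 (subst (p ≤_) size₀ p≤) =
      List.[ [] ] , (All.[] AllPairs.∷ AllPairs.[]) ,
      (λ { [] → mk⇔ (λ _ → nonNegative ∷ [-]) (λ _ → here refl) }) ,
      sym (count₀ q)
      where
      nonNegative : 0ℚ ℚ.≤ ℤ.+ u ℚ./ v
      nonNegative = from (/-≤ 0ℤ (ℤ.+ u) 1 v) (subst (0ℤ ℤ.≤_) (sym (ℤ.*-identityʳ (ℤ.+ u))) (ℤ.+≤+ z≤n))
    hall-cardinality (suc N) u v {q} {p} p≤ lower upper =
      hasCardinality-⇔ (λ w → ⇔-sym (hall⇔below sizes u v lower upper w)) (below-cardinality N q p p≤)

    -- Raising `p` by one adds the points with that last coordinate, counted by `hall-cardinality`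
    -- one dimension lower. At a carry, `suc q` with remainder 0 is the same bound as `q` with
    -- remainder `σ (suc N)`, and `wrap` matches the counts.
    below-cardinality : ∀ N q p → p ≤ σ (suc N) →
                        HasCardinality (Below sizes {N} (σ (suc N) * q + p)) (F (suc N) q p)
    below-cardinality N zero zero p≤ =
      subst₂ (λ j c → HasCardinality (Below sizes {N} j) c)
             (sym (trans (ℕ.+-identityʳ _) (ℕ.*-zeroʳ (σ (suc N))))) (sym start)
             (below-zero sizes (hall-cardinality N 0 (σ (suc N)) {q = 0} z≤n
               (ℕ.≤-reflexive (cong (_* σ (suc N)) zeroᵢ))
               (subst (λ j → 0 < suc j * σ (suc N)) (sym zeroᵢ)
                 (ℕ.>-nonZero⁻¹ (1 * σ (suc N)) {{ℕ.m*n≢0 1 (sizes N)}}))))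
      where
      open Step (steps N)
      zeroᵢ : σ N * 0 + 0 ≡ 0
      zeroᵢ = trans (ℕ.+-identityʳ (σ N * 0)) (ℕ.*-zeroʳ (σ N))
    below-cardinality N (suc q) zero p≤ =
      subst₂ (λ j c → HasCardinality (Below sizes {N} j) c) index (sym (wrap q))
             (below-cardinality N q (σ (suc N)) ℕ.≤-refl)
      where
      open Step (steps N)
      index : σ (suc N) * q + σ (suc N) ≡ σ (suc N) * suc q + 0
      index = trans (ℕ.+-comm _ (σ (suc N))) (trans (sym (ℕ.*-suc (σ (suc N)) q)) (sym (ℕ.+-identityʳ _)))
    below-cardinality N q (suc p) p< =
      subst₂ (λ j c → HasCardinality (Below sizes {N} j) c)
             (sym (ℕ.+-suc (σ (suc N) * q) p)) (sym (next q p<))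
             (below-suc sizes (below-cardinality N q p (ℕ.<⇒≤ p<))
               -- The multiple `σ N * q` splits off exactly from the quotient, so its integral part
               -- is `σ N * q + prev p`.
               (hall-cardinality N (suc (σ (suc N) * q + p)) (σ (suc N)) {q = q} (prev-≤ p<)
                 (subst₂ _≤_ (sym (expand (σ N) (σ (suc N)) q (prev p)))
                             (sym (expand′ (σ N) (σ (suc N)) q p))
                             (ℕ.+-monoʳ-≤ (σ N * q * σ (suc N)) (prev-low p<)))
                 (subst₂ _<_ (sym (expand′ (σ N) (σ (suc N)) q p))
                             (sym (expand″ (σ N) (σ (suc N)) q (prev p)))
                             (ℕ.+-monoʳ-< (σ N * q * σ (suc N)) (prev-high p<)))))
      where
      open Step (steps N)
      expand : ∀ a b q p → (a * q + p) * b ≡ a * q * b + p * b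
      expand = ℕ-solve-∀
      expand′ : ∀ a b q p → suc (b * q + p) * a ≡ a * q * b + suc p * a
      expand′ = ℕ-solve-∀
      expand″ : ∀ a b q p → suc (a * q + p) * b ≡ a * q * b + suc p * b
      expand″ = ℕ-solve-∀

  dilation-cardinality : ∀ N r t .{{_ : NonZero r}} .{{_ : NonZero t}} →
    HasCardinality (LatticePoint t (lectureHallSimplex (λ i → r * sizes i)
                                      {{λ {i} → ℕ.m*n≢0 r (sizes i)}} N))
                   (F N (t * r) 0)
  dilation-cardinality N r t = hasCardinality-⇔
    (λ z → ⇔-sym (latticePoint⇔hall sizes t r z))
    -- The bound is the integer `t * r`, so the quotient is exact and the remainder `p` is 0.
    (hall-cardinality N (t * r) 1 {q = t * r} z≤n
      (ℕ.≤-reflexive (lemma (σ N) (t * r)))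
      (subst (_< suc (σ N * (t * r) + 0) * 1) (lemma (σ N) (t * r))
             (ℕ.*-monoˡ-< 1 (ℕ.n<1+n (σ N * (t * r) + 0)))))
    where
    lemma : ∀ a b → (a * b + 0) * 1 ≡ b * a
    lemma = ℕ-solve-∀


-- The sequences 1,2,3,… and 1,1,3,2,5,3,…

onesCount : ℕ → ℕ → ℕ → ℕ
onesCount N       q zero    = suc q ^ N
-- A default for `p` above `N`, outside the range in which a count is used.
onesCount zero    q (suc p) = 0
onesCount (suc N) q (suc p) = suc (suc q) * onesCount N q p

onesStage : ℕ → Stage
onesStage N = stage N (onesCount N)

onesCount-wrap : ∀ N q → suc (suc q) ^ N ≡ onesCount N q N
onesCount-wrap zero    q = refl
onesCount-wrap (suc N) q = cong (suc (suc q) *_) (onesCount-wrap N q)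

-- After the common factor (q+2)^p is removed, this is (q+2)(q+1)^k = (q+1)^(k+1) + (q+1)^k with k =
-- N - p.
onesCount-next : ∀ {N p} q → p ≤ N →
                 onesCount (suc N) q (suc p) ≡ onesCount (suc N) q p + onesCount N q p
onesCount-next {N} q z≤n = ℕ.+-comm (suc q ^ N) (suc q ^ suc N)
onesCount-next {suc N} {suc p} q (s≤s p≤N) =
  trans (cong (suc (suc q) *_) (onesCount-next q p≤N))
        (ℕ.*-distribˡ-+ (suc (suc q)) (onesCount (suc N) q p) (onesCount N q p))

onesStep : ∀ N → Step (onesStage N) (onesStage (suc N))
onesStep N = record
  { nonZero   = _
  ; start     = ℕ.*-identityˡ (1 ^ N)
  ; wrap      = onesCount-wrap (suc N)
  -- (p+1) N / (N+1) exceeds p by (N-p) / (N+1), which lies in [0, 1).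
  ; prev      = λ p → p
  ; prev-≤    = s≤s⁻¹
  ; prev-low  = λ {p} p<N′ → subst₂ _≤_ (sym (ℕ.*-suc p N)) refl (ℕ.+-monoˡ-≤ (p * N) (s≤s⁻¹ p<N′))
  ; prev-high = λ {p} _ → ℕ.*-monoʳ-< (suc p) (ℕ.n<1+n N)
  ; next      = λ q p<N′ → onesCount-next q (s≤s⁻¹ p<N′)
  }

-- Triangular numbers and the second sequence

triangle : ℕ → ℕ
triangle q = multichoose (suc q) 2

multichoose-1 : ∀ n → multichoose n 1 ≡ n
multichoose-1 zero    = refl
multichoose-1 (suc n) = trans (ℕ.+-comm _ 1) (cong suc (multichoose-1 n))

triangle-suc : ∀ q → triangle (suc q) ≡ triangle q + suc (suc q)
triangle-suc q = cong (triangle q +_) (multichoose-1 (suc (suc q)))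

triangle-double : ∀ q → 2 * triangle q ≡ suc q * suc (suc q)
triangle-double zero    = refl
triangle-double (suc q) = begin
  2 * triangle (suc q)             ≡⟨ cong (2 *_) (triangle-suc q) ⟩
  2 * (triangle q + suc (suc q))   ≡⟨ ℕ.*-distribˡ-+ 2 (triangle q) (suc (suc q)) ⟩
  2 * triangle q + 2 * suc (suc q) ≡⟨ cong (_+ 2 * suc (suc q)) (triangle-double q) ⟩
  suc q * suc (suc q) + 2 * suc (suc q) ≡⟨ lemma q ⟩
  suc (suc q) * suc (suc (suc q))  ∎
  where
  lemma : ∀ q → suc q * suc (suc q) + 2 * suc (suc q) ≡ suc (suc q) * suc (suc (suc q))
  lemma = ℕ-solve-∀

-- Both sides are half of (q+1)(q+2)(q+3), with the division avoided through `triangle-double`. It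
-- links the two shapes of `oddCount`, with leading factor q+1 and q+2.
triangle-ratio : ∀ q → suc q * triangle (suc q) ≡ (3 + q) * triangle q
triangle-ratio q = begin
  suc q * triangle (suc q)               ≡⟨ cong (suc q *_) (triangle-suc q) ⟩
  suc q * (triangle q + suc (suc q))     ≡⟨ ℕ.*-distribˡ-+ (suc q) (triangle q) _ ⟩
  suc q * triangle q + suc q * suc (suc q) ≡⟨ cong (suc q * triangle q +_) (triangle-double q) ⟨
  suc q * triangle q + 2 * triangle q    ≡⟨ lemma q (triangle q) ⟩
  (3 + q) * triangle q                   ∎
  where
  lemma : ∀ q b → suc q * b + 2 * b ≡ (3 + q) * b
  lemma = ℕ-solve-∀

evenCount : ℕ → ℕ → ℕ → ℕ
evenCount i       q zero    = triangle q ^ i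
evenCount zero    q (suc p) = 0
evenCount (suc i) q (suc p) = triangle (suc q) * evenCount i q p

-- `p` is consumed in twos, as its parity decides between the leading factors q+1 and q+2; values of
-- `p` above the size default to 0.
oddCount : ℕ → ℕ → ℕ → ℕ
oddCount i       q zero          = suc q * triangle q ^ i
oddCount i       q (suc zero)    = suc (suc q) * triangle q ^ i
oddCount zero    q (suc (suc p)) = 0
oddCount (suc i) q (suc (suc p)) = triangle (suc q) * oddCount i q p

evenStage oddStage : ℕ → Stage
evenStage i = stage i (evenCount i)
oddStage  i = stage (suc (i * 2)) (oddCount i)

evenCount-wrap : ∀ i q → triangle (suc q) ^ i ≡ evenCount i q i
evenCount-wrap zero    q = refl
evenCount-wrap (suc i) q = cong (triangle (suc q) *_) (evenCount-wrap i q)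

oddCount-wrap : ∀ i q → suc (suc q) * triangle (suc q) ^ i ≡ oddCount i q (suc (i * 2))
oddCount-wrap zero    q = refl
oddCount-wrap (suc i) q =
  trans (lemma (suc (suc q)) (triangle (suc q)) (triangle (suc q) ^ i))
        (cong (triangle (suc q) *_) (oddCount-wrap i q))
  where
  lemma : ∀ a b c → a * (b * c) ≡ b * (a * c)
  lemma = ℕ-solve-∀

-- Without the common factor b′^p this is b′ = b + (q+2), times a power of b; `suc (p * 2)` selects
-- the odd count with leading factor q+2.
evenCount-next : ∀ {i p} q → p ≤ i →
                 evenCount (suc i) q (suc p) ≡ evenCount (suc i) q p + oddCount i q (suc (p * 2))
evenCount-next {i} q z≤n =
  trans (cong (_* triangle q ^ i) (triangle-suc q))
        (ℕ.*-distribʳ-+ (triangle q ^ i) (triangle q) _)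
evenCount-next q (s≤s p≤i) =
  trans (cong (triangle (suc q) *_) (evenCount-next q p≤i)) (ℕ.*-distribˡ-+ (triangle (suc q)) _ _)

-- Removing common factors leaves q+2 = (q+1) + 1 for even `p` and (q+1) b′ = (q+2) b + b for odd
-- `p`; the latter is `triangle-ratio`.
oddCount-next : ∀ i q p → p ≤ i * 2 →
                oddCount i q (suc p) ≡ oddCount i q p + evenCount i q ⌊ p /2⌋
oddCount-next i       q zero          _  = ℕ.+-comm (triangle q ^ i) _
oddCount-next (suc i) q (suc zero)    _  = begin
  triangle (suc q) * (suc q * triangle q ^ i)
    ≡⟨ lemma₁ (triangle (suc q)) (suc q) (triangle q ^ i) ⟩
  (suc q * triangle (suc q)) * triangle q ^ i
    ≡⟨ cong (_* triangle q ^ i) (triangle-ratio q) ⟩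
  ((3 + q) * triangle q) * triangle q ^ i
    ≡⟨ lemma₂ q (triangle q) (triangle q ^ i) ⟩
  (2 + q) * (triangle q * triangle q ^ i) + triangle q * triangle q ^ i ∎
  where
  lemma₁ : ∀ a b c → a * (b * c) ≡ (b * a) * c
  lemma₁ = ℕ-solve-∀
  lemma₂ : ∀ q b c → ((3 + q) * b) * c ≡ (2 + q) * (b * c) + b * c
  lemma₂ = ℕ-solve-∀
oddCount-next (suc i) q (suc (suc p)) p≤ =
  trans (cong (triangle (suc q) *_) (oddCount-next i q p (s≤s⁻¹ (s≤s⁻¹ p≤))))
        (ℕ.*-distribˡ-+ (triangle (suc q)) (oddCount i q p) _)

⌊n/2⌋*2≤n : ∀ n → ⌊ n /2⌋ * 2 ≤ n
⌊n/2⌋*2≤n zero          = z≤n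
⌊n/2⌋*2≤n (suc zero)    = z≤n
⌊n/2⌋*2≤n (suc (suc n)) = s≤s (s≤s (⌊n/2⌋*2≤n n))

n≤1+⌊n/2⌋*2 : ∀ n → n ≤ suc (⌊ n /2⌋ * 2)
n≤1+⌊n/2⌋*2 zero          = z≤n
n≤1+⌊n/2⌋*2 (suc zero)    = s≤s z≤n
n≤1+⌊n/2⌋*2 (suc (suc n)) = s≤s (s≤s (n≤1+⌊n/2⌋*2 n))

oddStep : ∀ i → Step (evenStage i) (oddStage i)
oddStep i = record
  { nonZero   = _
  ; start     = ℕ.*-identityˡ (1 ^ i)
  ; wrap      = oddCount-wrap i
  -- (p+1) i / (2i+1) falls short of (p+1) / 2 by a positive amount of at most 1/2, so its integral
  -- part is that of p / 2.
  ; prev      = ⌊_/2⌋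
  ; prev-≤    = half≤
  ; prev-low  = λ {p} p< → low p p<
  ; prev-high = λ {p} _ → high p
  ; next      = λ {p} q p< → oddCount-next i q p (s≤s⁻¹ p<)
  }
  where
  half≤ : ∀ {p} → p < suc (i * 2) → ⌊ p /2⌋ ≤ i
  half≤ {p} p< = ℕ.*-cancelʳ-≤ ⌊ p /2⌋ i 2 (ℕ.≤-trans (⌊n/2⌋*2≤n p) (s≤s⁻¹ p<))
  low : ∀ p → p < suc (i * 2) → ⌊ p /2⌋ * suc (i * 2) ≤ suc p * i
  low p p< = subst (_≤ suc p * i) (sym (lemma ⌊ p /2⌋ i))
    (ℕ.+-mono-≤ (half≤ p<) (ℕ.*-monoˡ-≤ i (⌊n/2⌋*2≤n p)))
    where
    lemma : ∀ h i → h * suc (i * 2) ≡ h + h * 2 * i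
    lemma = ℕ-solve-∀
  high : ∀ p → suc p * i < suc ⌊ p /2⌋ * suc (i * 2)
  high p = subst (suc p * i <_) (sym (lemma ⌊ p /2⌋ i))
    (s≤s (ℕ.≤-trans (ℕ.*-monoˡ-≤ i (s≤s (n≤1+⌊n/2⌋*2 p))) (ℕ.m≤n+m _ ⌊ p /2⌋)))
    where
    lemma : ∀ h i → suc h * suc (i * 2) ≡ suc (h + (2 + h * 2) * i)
    lemma = ℕ-solve-∀

evenStep : ∀ i → Step (oddStage i) (evenStage (suc i))
evenStep i = record
  { nonZero   = _
  ; start     = refl
  ; wrap      = evenCount-wrap (suc i)
  -- (p+1)(2i+1) / (i+1) falls short of 2p+2 by (p+1) / (i+1), which is positive and at most 1.
  ; prev      = λ p → suc (p * 2)
  ; prev-≤    = λ p< → s≤s (ℕ.*-monoˡ-≤ 2 (s≤s⁻¹ p<))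
  ; prev-low  = λ {p} p< → low p (s≤s⁻¹ p<)
  ; prev-high = λ {p} _ → high p
  ; next      = λ q p< → evenCount-next q (s≤s⁻¹ p<)
  }
  where
  low : ∀ p → p ≤ i → suc (p * 2) * suc i ≤ suc p * suc (i * 2)
  low p p≤i = subst₂ _≤_ (lemma₁ p i) (lemma₂ p i) (ℕ.+-monoʳ-≤ (p * i * 2 + p + i + 1) p≤i)
    where
    lemma₁ : ∀ p i → p * i * 2 + p + i + 1 + p ≡ suc (p * 2) * suc i
    lemma₁ = ℕ-solve-∀
    lemma₂ : ∀ p i → p * i * 2 + p + i + 1 + i ≡ suc p * suc (i * 2)
    lemma₂ = ℕ-solve-∀
  high : ∀ p → suc p * suc (i * 2) < suc (suc (p * 2)) * suc i
  high p = subst (suc p * suc (i * 2) <_) (lemma p i) (ℕ.m<m+n (suc p * suc (i * 2)) (s≤s z≤n))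
    where
    lemma : ∀ p i → suc p * suc (i * 2) + suc p ≡ suc (suc (p * 2)) * suc i
    lemma = ℕ-solve-∀

-- Counting from the even stage `i`, this is stage 2i + N of the second sequence; letting `i` absorb
-- pairs of coordinates settles the parity by pattern matching.
twosStage : ℕ → ℕ → Stage
twosStage i zero          = evenStage i
twosStage i (suc zero)    = oddStage i
twosStage i (suc (suc N)) = twosStage (suc i) N

twosStep : ∀ i N → Step (twosStage i N) (twosStage i (suc N))
twosStep i zero          = oddStep i
twosStep i (suc zero)    = evenStep i
twosStep i (suc (suc N)) = twosStep (suc i) N

replicate-ones : ∀ n q → onesCount (Vec.sum (replicate n 1)) q 0 ≡
                 multichooses (λ _ → suc q) (replicate n 1)
replicate-ones zero    q = refl
replicate-ones (suc n) q = cong₂ _*_ (sym (multichoose-1 (suc q))) (replicate-ones n q)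

private
  swap : ∀ a b c → (a * b) * c ≡ b * (a * c)
  swap = ℕ-solve-∀

-- Generalised over the offset `i`: each entry 2 raises the offset by one and supplies one more
-- factor `triangle q`.
replicate-twos : ∀ i n q → count (twosStage i (Vec.sum (replicate n 2))) q 0 ≡
                 triangle q ^ i * multichooses (λ _ → suc q) (replicate n 2)
replicate-twos i zero    q = sym (ℕ.*-identityʳ _)
replicate-twos i (suc n) q = trans (replicate-twos (suc i) n q) (swap (triangle q) (triangle q ^ i) _)

-- The final entry 1 leaves one coordinate beyond the pairs, so the recursion ends in an odd stage,
-- whose extra factor q+1 is that entry's factor.
replicate-twosOne : ∀ i n q → count (twosStage i (Vec.sum (replicate n 2 ∷ʳ 1))) q 0 ≡
                    triangle q ^ i * multichooses (λ _ → suc q) (replicate n 2 ∷ʳ 1)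
replicate-twosOne i zero    q = trans (ℕ.*-comm (suc q) (triangle q ^ i))
  (cong (triangle q ^ i *_) (sym (trans (ℕ.*-identityʳ _) (multichoose-1 (suc q)))))
replicate-twosOne i (suc n) q =
  trans (replicate-twosOne (suc i) n q) (swap (triangle q) (triangle q ^ i) _)

-- From the counts to the s-Eulerian property

multichooses-1 : ∀ {n} (m : Vec ℕ n) → multichooses (λ _ → 1) m ≡ 1
multichooses-1 []      = refl
multichooses-1 (a ∷ m) = cong₂ _*_ (lemma a) (multichooses-1 m)
  where
  lemma : ∀ a → multichoose 1 a ≡ 1
  lemma zero    = refl
  lemma (suc a) = lemma a

-- The Ehrhart count is the closed form at q = `t * r` and p = 0. The simplex has dimension
-- `Vec.sum m`, so its h*-polynomial is the same product of a series with a power of 1-x that gives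
-- the colored Eulerian polynomial.
stages⇒isSEulerian :
  (stages : ℕ → Stage) → size (stages 0) ≡ 0 → (∀ q → count (stages 0) q 0 ≡ 1) →
  (∀ N → Step (stages N) (stages (suc N))) →
  ∀ {n} r .{{_ : NonZero r}} (m : Vec ℕ n) → NonZero (Vec.sum m) →
  (∀ q → count (stages (Vec.sum m)) q 0 ≡ multichooses (λ _ → suc q) m) →
  IsSEulerian (coloredEulerian m (replicate n r))
stages⇒isSEulerian stages size₀ count₀ steps {n} r m nz counts≡ =
  (λ i → r * sizes stages size₀ count₀ steps i) ,
  positive ,
  Vec.sum m , nz , record
    { polynomial = Σₛ-polynomial (coloredPermutations m (replicate n r))
                                   (λ w → x^-polynomial (des w))
    ; ehrhart    = λ t → multichooses (λ _ → t * r + 1) m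
    ; isEhrhart  = record
      { constantTerm = multichooses-1 m
      ; counts       = λ t → subst (HasCardinality _)
          (trans (counts≡ (t * r)) (cong (λ a → multichooses (λ _ → a) m) (ℕ.+-comm 1 (t * r))))
          (dilation-cardinality stages size₀ count₀ steps (Vec.sum m) r t)
      }
    ; equation   = coloredEulerian-series r n m
    }
  where
  positive : ∀ {i} → NonZero (r * size (stages (suc i)))
  positive {i} = ℕ.m*n≢0 r (size (stages (suc i)))
    where instance _ = Step.nonZero (steps i)

proposition23 : (n r : ℕ) .{{_ : NonZero n}} .{{_ : NonZero r}} (m : Vec ℕ n) → OnesOrTwos m → IsSEulerian (coloredEulerian m (replicate n r))
proposition23 (suc n) r _ ones =
  stages⇒isSEulerian onesStage refl (λ _ → refl) onesStep r (replicate (suc n) 1) _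
    (replicate-ones (suc n))
proposition23 (suc n) r _ twos =
  stages⇒isSEulerian (twosStage 0) refl (λ _ → refl) (twosStep 0) r (replicate (suc n) 2) _
    (λ q → trans (replicate-twos 0 (suc n) q) (ℕ.+-identityʳ _))
proposition23 _ r _ (twosOne {n}) =
  stages⇒isSEulerian (twosStage 0) refl (λ _ → refl) (twosStep 0) r (replicate n 2 ∷ʳ 1) (nonZero n)
    (λ q → trans (replicate-twosOne 0 n q) (ℕ.+-identityʳ _))
  where
  nonZero : ∀ n → NonZero (Vec.sum (replicate n 2 ∷ʳ 1))
  nonZero zero    = _
  nonZero (suc n) = _
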